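{- Let $Q$ be a finite graded poset of rank $r$ with $|Q|=d$, and suppose that $d$ is odd. Let $\Omega(Q,k)$ be the order polynomial of $Q$. Then $$\sum_{m=0}^{N}(-1)^{N+m}\binom{d+2}{N-m}\,\Omega(Q,m(r+2)+1)=0,$$ where $N:=\lceil d/2\rceil$.
   Context: $C_k$ denotes the chain with $k$ elements. $\Omega(Q,k)$ is the order polynomial of $Q$: for positive integers $k$ it is the number of order-preserving maps $f:Q\to C_k$ (i.e. $x\le y$ implies $f(x)\le f(y)$). The poset $Q$ is graded of rank $r$ if all maximal chains of $Q$ have the same length $r$, where the length of a chain is its number of elements minus one. -}

module Defs where

open import Data.Fin.Base as Fin using (Fin; finToFun)
open import Data.Fin.Properties as Fin using (all?)
open import Data.Fin.Subset using (Subset; _∈_; _⊆_; ∣_∣)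
open import Data.List.Base using (List; length; filter; map; allFin)
open import Data.Nat.Base using (ℕ; suc; _^_)
open import Data.Product.Base using (_×_)
open import Data.Sum.Base using (_⊎_)
open import Function.Base using (_∘_)
open import Function.Bundles using (Inverse)
open import Level using (Level; _⊔_) renaming (suc to lsuc)
open import Relation.Binary.Bundles using (DecPoset)
open import Relation.Binary.Core using (_Preserves_⟶_)
open import Relation.Binary.PropositionalEquality using (_≡_; setoid; subst₂)
open import Relation.Nullary.Decidable using (Dec; map′; _→-dec_)

-- The order is assumed decidable: classically this is no restriction, and
-- constructively it is what makes counting order-preserving maps possible.
record FinitePoset c ℓ₁ ℓ₂ : Set (lsuc (c ⊔ ℓ₁ ⊔ ℓ₂)) where
  field
    decPoset    : DecPoset c ℓ₁ ℓ₂
    size        : ℕ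
    enumeration : Inverse (DecPoset.Eq.setoid decPoset) (setoid (Fin size))

  open DecPoset decPoset public
  open Inverse enumeration public using (to; from; strictlyInverseˡ; strictlyInverseʳ)

module _ {c ℓ₁ ℓ₂ : Level} (Q : FinitePoset c ℓ₁ ℓ₂) where

  open FinitePoset Q

  -- A subset of Q is represented by the set of indices of its elements:
  -- x belongs to it when to x ∈ C.
  IsChain : Subset size → Set (c ⊔ ℓ₂)
  IsChain C = ∀ x y → to x ∈ C → to y ∈ C → x ≤ y ⊎ y ≤ x

  IsMaximalChain : Subset size → Set (c ⊔ ℓ₂)
  IsMaximalChain C = IsChain C × (∀ D → IsChain D → C ⊆ D → D ⊆ C)

  -- A chain has length r when it has r + 1 elements.
  GradedOfRank : ℕ → Set (c ⊔ ℓ₂)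
  GradedOfRank r = ∀ C → IsMaximalChain C → ∣ C ∣ ≡ suc r

  -- A map Q → C_k, with C_k = Fin k, is given by its values f on indices.
  OrderPreserving : ∀ {k} → (Fin size → Fin k) → Set (c ⊔ ℓ₂)
  OrderPreserving f = (f ∘ to) Preserves _≤_ ⟶ Fin._≤_

  orderPreserving? : ∀ {k} (f : Fin size → Fin k) → Dec (OrderPreserving f)
  orderPreserving? f =
    map′ (λ mono {x} {y} x≤y → mono (to x) (to y) (reindex x≤y))
         (λ mono i j i≤j → subst₂ (λ a b → f a Fin.≤ f b)
                             (strictlyInverseˡ i) (strictlyInverseˡ j) (mono i≤j))
         (all? λ i → all? λ j → (from i ≤? from j) →-dec (f i Fin.≤? f j))
    where
    reindex : ∀ {x y} → x ≤ y → from (to x) ≤ from (to y)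
    reindex {x} {y} x≤y =
      trans (reflexive (strictlyInverseʳ x))
            (trans x≤y (reflexive (Eq.sym (strictlyInverseʳ y))))

  -- finToFun is a bijection from Fin (k ^ n) to Fin n → Fin k (up to
  -- pointwise equality), so each map occurs exactly once.
  allMaps : ∀ k → List (Fin size → Fin k)
  allMaps k = map finToFun (allFin (k ^ size))

  -- The value at k of the order polynomial, for k ≥ 1.
  Ω : ℕ → ℕ
  Ω k = length (filter orderPreserving? (allMaps k))

{-# OPTIONS --safe #-}
module Submission where

-- Put F_S(k) = the number of order-preserving maps S → C_k and F_S(-k) =
-- (-1)^|S| times the number of strict ones, for every subset S of Q. Cutting a
-- map at its largest value gives F_S(k + 1) = Σ F_J(k) over the down-sets J of S
-- for k ≥ 0; for k < 0 the same recursion holds because the sum over J of the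
-- signs between K and S cancels by toggling a minimal element of S \ K. Hence
-- the shift minus one strictly lowers |S|, and the (d + 2)-nd difference of
-- m ↦ F_Q(m(r + 2) + 1) vanishes. In a graded poset, adding the rank function
-- turns weak maps to C_k into strict maps to C_(k + r), so this sequence is
-- antisymmetric under m ↦ -m - 1 when d is odd. Therefore the 2N + 2 terms of
-- the difference agree in pairs, and half of them already sum to zero.

open import Defs
open import Data.Bool.Base using (Bool; not; if_then_else_)
import Data.Bool.Properties as Bool
open import Data.Fin.Base using (Fin; zero; suc; toℕ; _↑ˡ_; _↑ʳ_; combine; finToFun)
open import Data.Fin.Induction using (po-wellFounded)
import Data.Fin.Properties as Fin
open import Data.Fin.Properties using (any?; all?; remQuot-combine)
open import Data.Fin.Subset using (Subset; _∈_; _∉_; _⊆_; _⊃_; _∪_; ⁅_⁆; ∣_∣; inside; outside; ⊥; ⊤)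
open import Data.Fin.Subset.Induction using (⊃-wellFounded; Acc; acc)
open import Data.Fin.Subset.Properties
  using ( _∈?_; _⊆?_; ⊆-antisym; ∉⊥; ∈⊤; ∣⊥∣≡0; ∣⊤∣≡n; ∣⁅x⁆∣≡1; p⊂q⇒∣p∣<∣q∣; p⊆q⇒∣p∣≤∣q∣; drop-∷-⊆; in⊆in; out⊆
        ; x∈p∪q⁺; x∈p∪q⁻; x∈⁅x⁆; x∈⁅y⁆⇒x≡y; p⊆p∪q; q⊆p∪q; Empty-unique)
open import Data.Integer.Base as ℤ using (ℤ; +_; -[1+_]; 0ℤ; 1ℤ; -1ℤ; _*_; _-_; -_; _^_; _⊖_)
import Data.Integer.Properties as ℤ
open import Data.Integer.Properties using (+-0-monoid)
open import Algebra.Properties.Monoid.Sum +-0-monoid using (sum; sum-cong-≗; sum⁺-syntax)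
open import Data.Integer.Tactic.RingSolver using (solve-∀)
open import Data.List.Base as List using (List; []; _∷_; _++_; upTo; allFin)
import Data.List.Membership.Propositional as List
open import Data.List.Membership.Propositional using (find)
import Data.List.Membership.Propositional.Properties as List
import Data.List.Properties as List
open import Data.List.Relation.Unary.Any using (here; there)
open import Data.Nat.Base as ℕ using (ℕ; zero; suc; _+_; _∸_; _≤_; _<_; z≤n; s≤s; ⌈_/2⌉; parity)
import Data.Nat.Properties as ℕ
import Data.Nat.Tactic.RingSolver as ℕ-Solver
open import Data.Parity.Base using (1ℙ)
open import Data.Product.Base using (_×_; _,_; proj₁; proj₂; ∃-syntax)
open import Data.Sum.Base as Sum using (_⊎_; inj₁; inj₂; [_,_]′)
open import Data.Unit.Base using (tt) renaming (⊤ to Unit)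
open import Data.Vec.Base as Vec using (Vec; []; _∷_; _[_]%=_; lookup; here; there)
import Data.Vec.Properties as Vec
open import Function.Base using (_∘_; id)
open import Function.Bundles using (Inverse)
open import Level using (Level; 0ℓ)
open import Relation.Binary.Core using (Rel)
open import Relation.Binary.Definitions using () renaming (Decidable to Decidable₂)
open import Relation.Binary.PropositionalEquality
  using (_≡_; _≢_; _≗_; refl; sym; trans; cong; cong₂; subst; subst₂; isEquivalence; module ≡-Reasoning)
open import Relation.Binary.Structures using (IsDecPartialOrder)
open import Relation.Nullary using (¬_; contradiction)
open import Relation.Nullary.Decidable using (Dec; yes; no; does; _×-dec_; _⊎-dec_; _→-dec_; ¬?; dec-true)
open import Relation.Unary using (Pred; Decidable)

-- No polynomial is ever formed. The recursion in `k` leads from a poset to its subsets, so all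
-- subsets are treated at once. `orderFunction` takes reciprocity as the definition of the negative
-- values; what has to be proved is that a single recursion holds on both sides of zero, and the
-- degree appears only as the number of differences that vanish. The constant r + 2 comes from the
-- reflection k ↦ -(k + r): for k = m(r + 2) + 1 it sends m to -m - 1. The order d + 2 = 2N + 1 is
-- odd, so the signed binomial coefficients are antisymmetric too. Two antisymmetries multiply to a
-- symmetry, which is why the terms at m and -m - 1 agree instead of cancelling; m = -N - 1, ..., N
-- are the 2N + 2 points involved.

private variable
  a p q ℓ : Level
  A : Set a
  B : Set q
  P : Set p
  R : Set q
  n : ℕ

-- Sums of integers over lists

+-congˡ : ∀ w {x y} → x ≡ y → w ℤ.+ x ≡ w ℤ.+ y
+-congˡ w = cong (λ z → w ℤ.+ z)

∑ : List A → (A → ℤ) → ℤ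
∑ []       φ = 0ℤ
∑ (x ∷ xs) φ = φ x ℤ.+ ∑ xs φ

∑-cong-∈ : (xs : List A) {φ ψ : A → ℤ} → (∀ x → x List.∈ xs → φ x ≡ ψ x) → ∑ xs φ ≡ ∑ xs ψ
∑-cong-∈ []       φ≗ψ = refl
∑-cong-∈ (x ∷ xs) φ≗ψ = cong₂ ℤ._+_ (φ≗ψ x (here refl)) (∑-cong-∈ xs λ y → φ≗ψ y ∘ there)

∑-cong : (xs : List A) {φ ψ : A → ℤ} → φ ≗ ψ → ∑ xs φ ≡ ∑ xs ψ
∑-cong xs φ≗ψ = ∑-cong-∈ xs λ x _ → φ≗ψ x

∑-0 : (xs : List A) → ∑ xs (λ _ → 0ℤ) ≡ 0ℤ
∑-0 []       = refl
∑-0 (x ∷ xs) = trans (ℤ.+-identityˡ _) (∑-0 xs)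

∑-zero : (xs : List A) {φ : A → ℤ} → (∀ x → φ x ≡ 0ℤ) → ∑ xs φ ≡ 0ℤ
∑-zero xs φ≗0 = trans (∑-cong xs φ≗0) (∑-0 xs)

private
  +-interchange : ∀ w x y z → (w ℤ.+ x) ℤ.+ (y ℤ.+ z) ≡ (w ℤ.+ y) ℤ.+ (x ℤ.+ z)
  +-interchange = solve-∀

∑-+ : (xs : List A) (φ ψ : A → ℤ) → ∑ xs (λ x → φ x ℤ.+ ψ x) ≡ ∑ xs φ ℤ.+ ∑ xs ψ
∑-+ []       φ ψ = refl
∑-+ (x ∷ xs) φ ψ = trans (+-congˡ (φ x ℤ.+ ψ x) (∑-+ xs φ ψ)) (+-interchange (φ x) (ψ x) _ _)

∑-*ˡ : (xs : List A) (c : ℤ) (φ : A → ℤ) → ∑ xs (λ x → c * φ x) ≡ c * ∑ xs φ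
∑-*ˡ []       c φ = sym (ℤ.*-zeroʳ c)
∑-*ˡ (x ∷ xs) c φ = trans (+-congˡ (c * φ x) (∑-*ˡ xs c φ)) (sym (ℤ.*-distribˡ-+ c (φ x) _))

∑-neg : (xs : List A) (φ : A → ℤ) → ∑ xs (λ x → - φ x) ≡ - ∑ xs φ
∑-neg []       φ = refl
∑-neg (x ∷ xs) φ = trans (+-congˡ (- φ x) (∑-neg xs φ)) (sym (ℤ.neg-distrib-+ (φ x) _))

∑-swap : (xs : List A) (ys : List B) (φ : A → B → ℤ) →
         ∑ xs (λ x → ∑ ys (φ x)) ≡ ∑ ys (λ y → ∑ xs (λ x → φ x y))
∑-swap []       ys φ = sym (∑-0 ys)
∑-swap (x ∷ xs) ys φ = trans (+-congˡ (∑ ys (φ x)) (∑-swap xs ys φ)) (sym (∑-+ ys (φ x) _))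

∑-++ : (xs ys : List A) (φ : A → ℤ) → ∑ (xs ++ ys) φ ≡ ∑ xs φ ℤ.+ ∑ ys φ
∑-++ []       ys φ = sym (ℤ.+-identityˡ _)
∑-++ (x ∷ xs) ys φ = trans (+-congˡ (φ x) (∑-++ xs ys φ)) (sym (ℤ.+-assoc (φ x) _ _))

∑-map : (f : A → B) (xs : List A) (φ : B → ℤ) → ∑ (List.map f xs) φ ≡ ∑ xs (φ ∘ f)
∑-map f []       φ = refl
∑-map f (x ∷ xs) φ = +-congˡ (φ (f x)) (∑-map f xs φ)

∑-concatMap : (f : A → List B) (xs : List A) (φ : B → ℤ) →
              ∑ (List.concatMap f xs) φ ≡ ∑ xs (λ x → ∑ (f x) φ)
∑-concatMap f []       φ = refl
∑-concatMap f (x ∷ xs) φ = trans (∑-++ (f x) _ φ) (+-congˡ (∑ (f x) φ) (∑-concatMap f xs φ))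

-- Cartesian products of candidate lists, one list per coordinate

choices : Vec (List A) n → List (Vec A n)
choices []         = [] ∷ []
choices (xs ∷ xss) = List.concatMap (λ x → List.map (x ∷_) (choices xss)) xs

∑-choices-∷ : (xs : List A) (xss : Vec (List A) n) (φ : Vec A (suc n) → ℤ) →
              ∑ (choices (xs ∷ xss)) φ ≡ ∑ xs (λ x → ∑ (choices xss) (λ v → φ (x ∷ v)))
∑-choices-∷ xs xss φ = trans (∑-concatMap _ xs φ) (∑-cong xs λ x → ∑-map (x ∷_) (choices xss) φ)

-- Indicators of decidable propositions

𝟙 : Dec P → ℤ
𝟙 (yes _) = 1ℤ
𝟙 (no  _) = 0ℤ

𝟙-yes : (P? : Dec P) → P → 𝟙 P? ≡ 1ℤ
𝟙-yes (yes _) _  = refl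
𝟙-yes (no ¬P) p  = contradiction p ¬P

𝟙-no : (P? : Dec P) → ¬ P → 𝟙 P? ≡ 0ℤ
𝟙-no (yes p) ¬P = contradiction p ¬P
𝟙-no (no _)  _  = refl

𝟙-cong : (P? : Dec P) (R? : Dec R) → (P → R) → (R → P) → 𝟙 P? ≡ 𝟙 R?
𝟙-cong (yes p) R? f g = sym (𝟙-yes R? (f p))
𝟙-cong (no ¬p) R? f g = sym (𝟙-no R? (¬p ∘ g))

𝟙-× : (P? : Dec P) (R? : Dec R) → 𝟙 (P? ×-dec R?) ≡ 𝟙 P? * 𝟙 R?
𝟙-× (yes p) (yes q) = refl
𝟙-× (yes p) (no ¬q) = refl
𝟙-× (no ¬p) (yes q) = refl
𝟙-× (no ¬p) (no ¬q) = refl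

length-filter≡∑𝟙 : {P : Pred A p} (P? : Decidable P) (xs : List A) →
                   + List.length (List.filter P? xs) ≡ ∑ xs (λ x → 𝟙 (P? x))
length-filter≡∑𝟙 P? []       = refl
length-filter≡∑𝟙 P? (x ∷ xs) with P? x
... | yes _ = trans (ℤ.pos-+ 1 _) (+-congˡ 1ℤ (length-filter≡∑𝟙 P? xs))
... | no  _ = trans (length-filter≡∑𝟙 P? xs) (sym (ℤ.+-identityˡ _))

-- Subsets, signs and sign-reversing toggles

subsets : ∀ n → List (Subset n)
subsets n = choices (Vec.replicate n (inside ∷ outside ∷ []))

∑-subsets-suc : ∀ n (φ : Subset (suc n) → ℤ) → ∑ (subsets (suc n)) φ ≡
                ∑ (subsets n) (φ ∘ (inside ∷_)) ℤ.+ ∑ (subsets n) (φ ∘ (outside ∷_))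
∑-subsets-suc n φ = trans (∑-choices-∷ (inside ∷ outside ∷ []) (Vec.replicate n _) φ)
  (+-congˡ (∑ (subsets n) (φ ∘ (inside ∷_))) (ℤ.+-identityʳ _))

toggle : Fin n → Subset n → Subset n
toggle i S = S [ i ]%= not

∑-toggle : (i : Fin n) (φ : Subset n → ℤ) → ∑ (subsets n) (φ ∘ toggle i) ≡ ∑ (subsets n) φ
∑-toggle {suc n} zero    φ = trans (∑-subsets-suc n (φ ∘ toggle zero))
  (trans (ℤ.+-comm (∑ (subsets n) (φ ∘ (outside ∷_))) _) (sym (∑-subsets-suc n φ)))
∑-toggle {suc n} (suc i) φ = trans (∑-subsets-suc n (φ ∘ toggle (suc i)))
  (trans (cong₂ ℤ._+_ (∑-toggle i (φ ∘ (inside ∷_))) (∑-toggle i (φ ∘ (outside ∷_))))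
         (sym (∑-subsets-suc n φ)))

x+x≡0⇒x≡0 : ∀ x → x ℤ.+ x ≡ 0ℤ → x ≡ 0ℤ
-- For every other constructor form the double computes to a nonzero integer, so `eq` is absurd.
x+x≡0⇒x≡0 (+ zero)    eq = refl

-- A sign-reversing involution without any pairing of terms: reindexing by the toggle makes the sum
-- its own negative, and the integers have no 2-torsion.
∑-toggle-odd : (i : Fin n) (φ : Subset n → ℤ) → (∀ S → φ (toggle i S) ≡ - φ S) →
               ∑ (subsets n) φ ≡ 0ℤ
∑-toggle-odd {n} i φ odd = x+x≡0⇒x≡0 s (trans (cong₂ ℤ._+_ eq (refl {x = s})) (ℤ.+-inverseˡ s))
  where
  s = ∑ (subsets n) φ
  eq : s ≡ - s
  eq = trans (sym (∑-toggle i φ)) (trans (∑-cong (subsets n) odd) (∑-neg (subsets n) φ))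

sgn : Subset n → ℤ
sgn S = -1ℤ ^ ∣ S ∣

sgn-toggle : (i : Fin n) (S : Subset n) → sgn (toggle i S) ≡ - sgn S
sgn-toggle zero    (inside  ∷ S) = neg-neg (sgn S)
  where neg-neg : ∀ x → x ≡ - (-1ℤ * x)
        neg-neg = solve-∀
sgn-toggle zero    (outside ∷ S) = ℤ.-1*i≡-i (sgn S)
sgn-toggle (suc i) (inside  ∷ S) = trans (cong (-1ℤ *_) (sgn-toggle i S)) (sym (ℤ.neg-distribʳ-* -1ℤ (sgn S)))
sgn-toggle (suc i) (outside ∷ S) = sgn-toggle i S

infix 4 _≟_
_≟_ : Decidable₂ (_≡_ {A = Subset n})
_≟_ = Vec.≡-dec Bool._≟_

∑-δ : (S : Subset n) (φ : Subset n → ℤ) → ∑ (subsets n) (λ J → 𝟙 (J ≟ S) * φ J) ≡ φ S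
∑-δ {zero} [] φ = trans (ℤ.+-identityʳ _) (ℤ.*-identityˡ (φ []))
∑-δ {suc n} (s ∷ S) φ = begin
  ∑ (subsets (suc n)) (λ J → 𝟙 (J ≟ s ∷ S) * φ J)
    ≡⟨ ∑-subsets-suc n _ ⟩
  half inside s ℤ.+ half outside s
    ≡⟨ split s ⟩
  φ (s ∷ S) ∎
  where
  open ≡-Reasoning
  half : Bool → Bool → ℤ
  half b s = ∑ (subsets n) (λ J → 𝟙 (b ∷ J ≟ s ∷ S) * φ (b ∷ J))
  same : ∀ b → half b b ≡ φ (b ∷ S)
  same b = trans (∑-cong (subsets n) λ J →
                   cong (_* φ (b ∷ J)) (𝟙-cong (b ∷ J ≟ b ∷ S) (J ≟ S) Vec.∷-injectiveʳ (cong (b ∷_))))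
                 (∑-δ S (φ ∘ (b ∷_)))
  different : ∀ b s → b ≢ s → half b s ≡ 0ℤ
  different b s b≢s = ∑-zero (subsets n) λ J →
    cong (_* φ (b ∷ J)) (𝟙-no (b ∷ J ≟ s ∷ S) (b≢s ∘ Vec.∷-injectiveˡ))
  split : ∀ s → half inside s ℤ.+ half outside s ≡ φ (s ∷ S)
  split inside  = trans (cong₂ ℤ._+_ (same inside) (different outside inside λ ())) (ℤ.+-identityʳ _)
  split outside = trans (cong₂ ℤ._+_ (different inside outside λ ()) (same outside)) (ℤ.+-identityˡ _)

toggle-involutive : (i : Fin n) (S : Subset n) → toggle i (toggle i S) ≡ S
toggle-involutive i S = trans (Vec.updateAt-updateAt-local i S (Bool.not-involutive _)) (Vec.updateAt-id i S)

∈-toggle : {i : Fin n} {S : Subset n} → i ∉ S → i ∈ toggle i S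
∈-toggle {i = i} {S} i∉S = Vec.lookup⇒[]= i _ (trans (Vec.lookup∘updateAt i S)
  (cong not (Bool.¬-not (i∉S ∘ Vec.lookup⇒[]= i S))))

∉-toggle : {i : Fin n} {S : Subset n} → i ∈ S → i ∉ toggle i S
∉-toggle {i = i} {S} i∈S i∈S′
  with () ← trans (sym (Vec.[]=⇒lookup i∈S′)) (trans (Vec.lookup∘updateAt i S) (cong not (Vec.[]=⇒lookup i∈S)))

∈-toggle⁺ : {i j : Fin n} {S : Subset n} → i ≢ j → i ∈ S → i ∈ toggle j S
∈-toggle⁺ {i = i} {j} {S} i≢j i∈S = Vec.lookup⇒[]= i _ (trans (Vec.lookup∘updateAt′ i j i≢j S) (Vec.[]=⇒lookup i∈S))

∈-toggle⁻ : {i j : Fin n} {S : Subset n} → i ≢ j → i ∈ toggle j S → i ∈ S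
∈-toggle⁻ {i = i} {j} {S} i≢j i∈S = Vec.lookup⇒[]= i _ (trans (sym (Vec.lookup∘updateAt′ i j i≢j S)) (Vec.[]=⇒lookup i∈S))

-- Finite differences

-- Iterated forward difference of step `a`. One difference is applied to `f` before the others, so
-- that a formula for a single difference of `f` can be inserted under the rest by `Δ^-cong`.
Δ^ : ℕ → ℕ → (ℕ → ℤ) → ℕ → ℤ
Δ^ a zero    f = f
Δ^ a (suc n) f = Δ^ a n (λ t → f (a + t) - f t)

Δ^-cong : ∀ a n {f g : ℕ → ℤ} → f ≗ g → Δ^ a n f ≗ Δ^ a n g
Δ^-cong a zero    f≗g = f≗g
Δ^-cong a (suc n) f≗g = Δ^-cong a n λ t → cong₂ _-_ (f≗g (a + t)) (f≗g t)

Δ^-+ : ∀ a n (f g : ℕ → ℤ) t → Δ^ a n (λ t → f t ℤ.+ g t) t ≡ Δ^ a n f t ℤ.+ Δ^ a n g t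
Δ^-+ a zero    f g t = refl
Δ^-+ a (suc n) f g t = trans
  (Δ^-cong a n (λ t → regroup (f (a + t)) (g (a + t)) (f t) (g t)) t)
  (Δ^-+ a n (λ t → f (a + t) - f t) (λ t → g (a + t) - g t) t)
  where
  regroup : ∀ w x y z → (w ℤ.+ x) - (y ℤ.+ z) ≡ (w - y) ℤ.+ (x - z)
  regroup = solve-∀

Δ^-* : ∀ a n (c : ℤ) (f : ℕ → ℤ) t → Δ^ a n (λ t → c * f t) t ≡ c * Δ^ a n f t
Δ^-* a zero    c f t = refl
Δ^-* a (suc n) c f t = trans
  (Δ^-cong a n (λ t → factor c (f (a + t)) (f t)) t)
  (Δ^-* a n c (λ t → f (a + t) - f t) t)
  where
  factor : ∀ c x y → c * x - c * y ≡ c * (x - y)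
  factor = solve-∀

Δ^-0 : ∀ a n t → Δ^ a n (λ _ → 0ℤ) t ≡ 0ℤ
Δ^-0 a zero    t = refl
Δ^-0 a (suc n) t = Δ^-0 a n t

Δ^-∑ : ∀ a n (xs : List B) (f : B → ℕ → ℤ) t →
       Δ^ a n (λ t → ∑ xs (λ x → f x t)) t ≡ ∑ xs (λ x → Δ^ a n (f x) t)
Δ^-∑ a n []       f t = Δ^-0 a n t
Δ^-∑ a n (x ∷ xs) f t = trans (Δ^-+ a n (f x) _ t) (+-congˡ (Δ^ a n (f x) t) (Δ^-∑ a n xs f t))

Δ^-shift : ∀ a n s (f : ℕ → ℤ) t → Δ^ a n (λ t → f (s + t)) t ≡ Δ^ a n f (s + t)
Δ^-shift a zero    s f t = refl
Δ^-shift a (suc n) s f t = trans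
  (Δ^-cong a n (λ t → cong (λ u → f u - f (s + t)) (swap s t)) t)
  (Δ^-shift a n s (λ t → f (a + t) - f t) t)
  where
  swap : ∀ s t → s + (a + t) ≡ a + (s + t)
  swap s t = trans (sym (ℕ.+-assoc s a t)) (trans (cong (ℕ._+ t) (ℕ.+-comm s a)) (ℕ.+-assoc a s t))

-- E^c - 1 is divisible by E - 1, where E is the unit shift.
Δ^-coarsen : ∀ a n (f : ℕ → ℤ) → (∀ t → Δ^ a n (λ t → f (suc t) - f t) t ≡ 0ℤ) →
             ∀ c t → Δ^ a n (λ t → f (c + t) - f t) t ≡ 0ℤ
Δ^-coarsen a n f vanish zero    t = trans (Δ^-cong a n (λ t → ℤ.+-inverseʳ (f t)) t) (Δ^-0 a n t)
Δ^-coarsen a n f vanish (suc c) t = begin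
  Δ^ a n (λ t → f (suc (c + t)) - f t) t
    ≡⟨ Δ^-cong a n (λ t → telescope (f (suc (c + t))) (f (c + t)) (f t)) t ⟩
  Δ^ a n (λ t → (f (suc (c + t)) - f (c + t)) ℤ.+ (f (c + t) - f t)) t
    ≡⟨ Δ^-+ a n (λ t → f (suc (c + t)) - f (c + t)) _ t ⟩
  Δ^ a n (λ t → f (suc (c + t)) - f (c + t)) t ℤ.+ Δ^ a n (λ t → f (c + t) - f t) t
    ≡⟨ cong₂ ℤ._+_ (trans (Δ^-shift a n c (λ t → f (suc t) - f t) t) (vanish (c + t)))
                 (Δ^-coarsen a n f vanish c t) ⟩
  0ℤ ∎
  where
  open ≡-Reasoning
  telescope : ∀ x y z → x - z ≡ (x - y) ℤ.+ (y - z)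
  telescope = solve-∀

-- Sums over initial segments of the naturals

∑< : ℕ → (ℕ → ℤ) → ℤ
∑< n h = sum {n} (h ∘ toℕ)

∑<-cong : ∀ n {g h : ℕ → ℤ} → (∀ m → m < n → g m ≡ h m) → ∑< n g ≡ ∑< n h
∑<-cong n g≗h = sum-cong-≗ λ i → g≗h (toℕ i) (Fin.toℕ<n i)

∑<-last : ∀ n (h : ℕ → ℤ) → ∑< (suc n) h ≡ ∑< n h ℤ.+ h n
∑<-last zero    h = ℤ.+-comm (h 0) 0ℤ
∑<-last (suc n) h = trans (+-congˡ (h 0) (∑<-last n (h ∘ suc))) (sym (ℤ.+-assoc (h 0) _ _))

∑<-- : ∀ n (g h : ℕ → ℤ) → ∑< n (λ m → g m - h m) ≡ ∑< n g - ∑< n h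
∑<-- zero    g h = refl
∑<-- (suc n) g h = trans (+-congˡ (g 0 - h 0) (∑<-- n (g ∘ suc) (h ∘ suc)))
  (regroup (g 0) (h 0) _ _)
  where
  regroup : ∀ w x y z → (w - x) ℤ.+ (y - z) ≡ (w ℤ.+ y) - (x ℤ.+ z)
  regroup = solve-∀

∑<-split : ∀ m n (h : ℕ → ℤ) → ∑< (m + n) h ≡ ∑< m h ℤ.+ ∑< n (λ k → h (m + k))
∑<-split zero    n h = sym (ℤ.+-identityˡ _)
∑<-split (suc m) n h = trans (+-congˡ (h 0) (∑<-split m n (h ∘ suc))) (sym (ℤ.+-assoc (h 0) _ _))

∑<-reverse : ∀ n (h : ℕ → ℤ) → ∑< (suc n) h ≡ ∑< (suc n) (λ m → h (n ∸ m))
∑<-reverse zero    h = refl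
∑<-reverse (suc n) h = begin
  ∑< (suc (suc n)) h                                  ≡⟨ ∑<-last (suc n) h ⟩
  ∑< (suc n) h ℤ.+ h (suc n)                          ≡⟨ ℤ.+-comm _ (h (suc n)) ⟩
  h (suc n) ℤ.+ ∑< (suc n) h                          ≡⟨ +-congˡ (h (suc n)) (∑<-reverse n h) ⟩
  h (suc n) ℤ.+ ∑< (suc n) (λ m → h (n ∸ m)) ∎
  where open ≡-Reasoning

-- Reindexing the enumeration of maps

∈-choices⁻ : (xss : Vec (List A) n) {v : Vec A n} → v List.∈ choices xss → ∀ i → lookup v i List.∈ lookup xss i
∈-choices⁻ (xs ∷ xss) v∈ i
  with x , x∈xs , v∈′ ← find (List.∈-concatMap⁻ (λ x → List.map (x ∷_) (choices xss)) {xs = xs} v∈)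
  with w , w∈ , refl ← List.∈-map⁻ (x ∷_) v∈′
  with i
... | zero  = x∈xs
... | suc j = ∈-choices⁻ xss w∈ j

∑-tabulate : (f : Fin n → A) (φ : A → ℤ) → ∑ (List.tabulate f) φ ≡ ∑ (allFin n) (φ ∘ f)
∑-tabulate f φ = trans (cong (λ xs → ∑ xs φ) (sym (List.map-tabulate id f))) (∑-map f (allFin _) φ)

∑-allFin-+ : ∀ m n (φ : Fin (m + n) → ℤ) →
             ∑ (allFin (m + n)) φ ≡ ∑ (allFin m) (λ i → φ (i ↑ˡ n)) ℤ.+ ∑ (allFin n) (λ j → φ (m ↑ʳ j))
∑-allFin-+ zero    n φ = sym (ℤ.+-identityˡ _)
∑-allFin-+ (suc m) n φ = begin
  φ zero ℤ.+ ∑ (List.tabulate suc) φ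
    ≡⟨ +-congˡ (φ zero) (trans (∑-tabulate suc φ) (∑-allFin-+ m n (φ ∘ suc))) ⟩
  φ zero ℤ.+ (∑ (allFin m) (λ i → φ (suc (i ↑ˡ n))) ℤ.+ rest)
    ≡⟨ sym (ℤ.+-assoc (φ zero) _ rest) ⟩
  φ zero ℤ.+ ∑ (allFin m) (λ i → φ (suc (i ↑ˡ n))) ℤ.+ rest
    ≡⟨ cong (λ z → φ zero ℤ.+ z ℤ.+ rest) (sym (∑-tabulate suc (λ i → φ (i ↑ˡ n)))) ⟩
  φ zero ℤ.+ ∑ (List.tabulate suc) (λ i → φ (i ↑ˡ n)) ℤ.+ rest ∎
  where
  open ≡-Reasoning
  rest = ∑ (allFin n) (λ j → φ (suc m ↑ʳ j))

∑-allFin-* : ∀ m n (φ : Fin (m ℕ.* n) → ℤ) →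
             ∑ (allFin (m ℕ.* n)) φ ≡ ∑ (allFin m) (λ i → ∑ (allFin n) (λ j → φ (combine i j)))
∑-allFin-* zero    n φ = refl
∑-allFin-* (suc m) n φ = trans (∑-allFin-+ n (m ℕ.* n) φ)
  (+-congˡ (∑ (allFin n) (λ j → φ (j ↑ˡ (m ℕ.* n)))) (trans (∑-allFin-* m n (φ ∘ (n ↑ʳ_)))
    (sym (∑-tabulate {n = m} suc (λ i → ∑ (allFin n) (λ j → φ (combine i j)))))))

∑-applyUpTo : ∀ k (f : ℕ → ℕ) (φ : ℕ → ℤ) → ∑ (List.applyUpTo f k) φ ≡ ∑ (allFin k) (φ ∘ f ∘ toℕ)
∑-applyUpTo zero    f φ = refl
∑-applyUpTo (suc k) f φ = +-congˡ (φ (f 0))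
  (trans (∑-applyUpTo k (f ∘ suc) φ) (sym (∑-tabulate {n = k} suc (φ ∘ f ∘ toℕ))))

∑-upTo-last : ∀ k (φ : ℕ → ℤ) → ∑ (upTo (suc k)) φ ≡ ∑ (upTo k) φ ℤ.+ φ k
∑-upTo-last k φ = trans (cong (λ xs → ∑ xs φ) (sym (List.upTo-∷ʳ k)))
  (trans (∑-++ (upTo k) (k ∷ []) φ) (+-congˡ (∑ (upTo k) φ) (ℤ.+-identityʳ (φ k))))

-- `finToFun` reads an index below `k ^ n` as a string of base-`k` digits; splitting off the leading
-- digit with `combine` matches the head of the Cartesian product.
∑-finToFun : ∀ n k (φ : Vec ℕ n → ℤ) →
  ∑ (allFin (k ℕ.^ n)) (λ i → φ (Vec.tabulate (toℕ ∘ finToFun {k} {n} i))) ≡ ∑ (choices (Vec.replicate n (upTo k))) φ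
∑-finToFun zero    k φ = refl
∑-finToFun (suc n) k φ = begin
  ∑ (allFin (k ℕ.* k ℕ.^ n)) (λ i → φ (Vec.tabulate (toℕ ∘ finToFun {k} {suc n} i)))
    ≡⟨ ∑-allFin-* k (k ℕ.^ n) _ ⟩
  ∑ (allFin k) (λ a → ∑ (allFin (k ℕ.^ n)) (λ b → φ (Vec.tabulate (toℕ ∘ finToFun {k} {suc n} (combine a b)))))
    ≡⟨ ∑-cong (allFin k) (λ a → ∑-cong (allFin (k ℕ.^ n)) λ b →
         cong (λ qr → φ (toℕ (proj₁ qr) ∷ Vec.tabulate (toℕ ∘ finToFun {k} {n} (proj₂ qr)))) (remQuot-combine a b)) ⟩
  ∑ (allFin k) (λ a → ∑ (allFin (k ℕ.^ n)) (λ b → φ (toℕ a ∷ Vec.tabulate (toℕ ∘ finToFun {k} {n} b))))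
    ≡⟨ ∑-cong (allFin k) (λ a → ∑-finToFun n k (φ ∘ (toℕ a ∷_))) ⟩
  ∑ (allFin k) (λ a → ∑ (choices (Vec.replicate n (upTo k))) (λ f → φ (toℕ a ∷ f)))
    ≡⟨ ∑-applyUpTo k id _ ⟨
  ∑ (upTo k) (λ v → ∑ (choices (Vec.replicate n (upTo k))) (λ f → φ (v ∷ f)))
    ≡⟨ ∑-choices-∷ (upTo k) (Vec.replicate n (upTo k)) φ ⟨
  ∑ (choices (upTo k ∷ Vec.replicate n (upTo k))) φ ∎
  where open ≡-Reasoning

-- Partial maps on a subset, cut at the largest value

-- A map S → {0, …, k - 1} is a vector that has the junk value 0 outside S.
values : ℕ → Subset n → Vec (List ℕ) n
values k = Vec.map (λ s → if s then upTo k else 0 ∷ [])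

-- Extension of `f` from `J` to `S` by the new top value `k`. The entry is kept outside `S`, where
-- it is junk; sets `J` that are not inside `S` are later weighted by zero.
extend : ℕ → Subset n → Subset n → Vec ℕ n → Vec ℕ n
extend k []            []            []      = []
extend k (inside  ∷ S) (outside ∷ J) (v ∷ f) = k ∷ extend k S J f
extend k (inside  ∷ S) (inside  ∷ J) (v ∷ f) = v ∷ extend k S J f
extend k (outside ∷ S) (_       ∷ J) (v ∷ f) = v ∷ extend k S J f

lookup-extend-∈ : ∀ k (S J : Subset n) f {i} → i ∈ J → lookup (extend k S J f) i ≡ lookup f i
lookup-extend-∈ k (inside  ∷ S) (inside  ∷ J) (v ∷ f) here        = refl
lookup-extend-∈ k (outside ∷ S) (inside  ∷ J) (v ∷ f) here        = refl
lookup-extend-∈ k (inside  ∷ S) (inside  ∷ J) (v ∷ f) (there i∈J) = lookup-extend-∈ k S J f i∈J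
lookup-extend-∈ k (inside  ∷ S) (outside ∷ J) (v ∷ f) (there i∈J) = lookup-extend-∈ k S J f i∈J
lookup-extend-∈ k (outside ∷ S) (_       ∷ J) (v ∷ f) (there i∈J) = lookup-extend-∈ k S J f i∈J

lookup-extend-∉ : ∀ k (S J : Subset n) f {i} → i ∈ S → i ∉ J → lookup (extend k S J f) i ≡ k
lookup-extend-∉ k (inside  ∷ S) (outside ∷ J) (v ∷ f) here        i∉J = refl
lookup-extend-∉ k (inside  ∷ S) (inside  ∷ J) (v ∷ f) here        i∉J = contradiction here i∉J
lookup-extend-∉ k (inside  ∷ S) (inside  ∷ J) (v ∷ f) (there i∈S) i∉J = lookup-extend-∉ k S J f i∈S (i∉J ∘ there)
lookup-extend-∉ k (inside  ∷ S) (outside ∷ J) (v ∷ f) (there i∈S) i∉J = lookup-extend-∉ k S J f i∈S (i∉J ∘ there)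
lookup-extend-∉ k (outside ∷ S) (_       ∷ J) (v ∷ f) (there i∈S) i∉J = lookup-extend-∉ k S J f i∈S (i∉J ∘ there)

-- `upTo 0` is empty, so a single point of `S` kills the whole product; for empty `S` exactly one
-- vector, all junk, remains.
∑-values-zero : (S : Subset n) (φ : Vec ℕ n → ℤ) →
                ∑ (choices (values 0 S)) φ ≡ 𝟙 (S ≟ ⊥) * φ (Vec.replicate n 0)
∑-values-zero []            φ = trans (ℤ.+-identityʳ (φ [])) (sym (ℤ.*-identityˡ (φ [])))
∑-values-zero {suc n} (inside ∷ S) φ = sym (cong (_* φ (Vec.replicate (suc n) 0)) (𝟙-no (inside ∷ S ≟ ⊥) λ ()))
∑-values-zero (outside ∷ S) φ = begin
  ∑ (choices (values 0 (outside ∷ S))) φ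
    ≡⟨ ∑-choices-∷ (0 ∷ []) (values 0 S) φ ⟩
  ∑ (choices (values 0 S)) (φ ∘ (0 ∷_)) ℤ.+ 0ℤ
    ≡⟨ ℤ.+-identityʳ _ ⟩
  ∑ (choices (values 0 S)) (φ ∘ (0 ∷_))
    ≡⟨ ∑-values-zero S (φ ∘ (0 ∷_)) ⟩
  𝟙 (S ≟ ⊥) * φ (0 ∷ Vec.replicate _ 0)
    ≡⟨ cong (_* φ _) (𝟙-cong (S ≟ ⊥) (outside ∷ S ≟ ⊥) (cong (outside ∷_)) Vec.∷-injectiveʳ) ⟩
  𝟙 (outside ∷ S ≟ ⊥) * φ (0 ∷ Vec.replicate _ 0) ∎
  where open ≡-Reasoning

-- A map to {0, ..., k} amounts to the set `J` of points with value below `k` together with its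
-- restriction to `J`. Coordinatewise, the last entry of `upTo (suc k)` is the choice of staying
-- outside `J`. No order is involved yet, hence the arbitrary `φ`.
∑-values-suc : ∀ k (S : Subset n) (φ : Vec ℕ n → ℤ) →
  ∑ (choices (values (suc k) S)) φ ≡
  ∑ (subsets n) (λ J → 𝟙 (J ⊆? S) * ∑ (choices (values k J)) (φ ∘ extend k S J))
∑-values-suc k []      φ = sym (trans (ℤ.+-identityʳ _) (trans
  (cong (_* (φ [] ℤ.+ 0ℤ)) (𝟙-yes ([] ⊆? []) id)) (ℤ.*-identityˡ (φ [] ℤ.+ 0ℤ))))
∑-values-suc {suc n} k (s ∷ S) φ = trans (expand s) (sym (∑-subsets-suc n _))
  where
  open ≡-Reasoning
  term : ℕ → Subset n → ℤ
  term v J = 𝟙 (J ⊆? S) * ∑ (choices (values k J)) (λ f → φ (v ∷ extend k S J f))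
  total : ℕ → ℤ
  total v = ∑ (subsets n) (term v)
  half : Bool → Bool → ℤ
  half s j = ∑ (subsets n) (λ J →
    𝟙 ((j ∷ J) ⊆? (s ∷ S)) * ∑ (choices (values k (j ∷ J))) (φ ∘ extend k (s ∷ S) (j ∷ J)))
  in-in : half inside inside ≡ ∑ (upTo k) total
  in-in = sym (trans (∑-swap (upTo k) (subsets n) term) (∑-cong (subsets n) λ J → trans
    (∑-*ˡ (upTo k) (𝟙 (J ⊆? S)) _)
    (cong₂ _*_ (𝟙-cong (J ⊆? S) ((inside ∷ J) ⊆? (inside ∷ S)) in⊆in drop-∷-⊆)
               (sym (∑-choices-∷ (upTo k) (values k J) _)))))
  singleton : ∀ J (ψ : Vec ℕ (suc n) → ℤ) →
              ∑ (choices (values k (outside ∷ J))) ψ ≡ ∑ (choices (values k J)) (ψ ∘ (0 ∷_))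
  singleton J ψ = trans (∑-choices-∷ (0 ∷ []) (values k J) ψ) (ℤ.+-identityʳ _)
  in-out : half inside outside ≡ total k
  in-out = ∑-cong (subsets n) λ J →
    cong₂ _*_ (𝟙-cong ((outside ∷ J) ⊆? (inside ∷ S)) (J ⊆? S) drop-∷-⊆ out⊆) (singleton J _)
  out-in : half outside inside ≡ 0ℤ
  out-in = ∑-zero (subsets n) λ J →
    cong (_* ∑ (choices (values k (inside ∷ J))) (φ ∘ extend k (outside ∷ S) (inside ∷ J)))
         (𝟙-no ((inside ∷ J) ⊆? (outside ∷ S)) λ sub → case (sub here))
    where case : ¬ (zero ∈ outside ∷ S)
          case ()
  out-out : half outside outside ≡ total 0
  out-out = ∑-cong (subsets n) λ J →
    cong₂ _*_ (𝟙-cong ((outside ∷ J) ⊆? (outside ∷ S)) (J ⊆? S) drop-∷-⊆ out⊆) (singleton J _)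
  expand : ∀ s → ∑ (choices (values (suc k) (s ∷ S))) φ ≡ half s inside ℤ.+ half s outside
  expand inside = begin
    ∑ (choices (values (suc k) (inside ∷ S))) φ
      ≡⟨ ∑-choices-∷ (upTo (suc k)) (values (suc k) S) φ ⟩
    ∑ (upTo (suc k)) (λ v → ∑ (choices (values (suc k) S)) (λ f → φ (v ∷ f)))
      ≡⟨ ∑-cong (upTo (suc k)) (λ v → ∑-values-suc k S (φ ∘ (v ∷_))) ⟩
    ∑ (upTo (suc k)) total
      ≡⟨ ∑-upTo-last k total ⟩
    ∑ (upTo k) total ℤ.+ total k
      ≡⟨ cong₂ ℤ._+_ in-in in-out ⟨
    half inside inside ℤ.+ half inside outside ∎
  expand outside = begin
    ∑ (choices (values (suc k) (outside ∷ S))) φ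
      ≡⟨ ∑-choices-∷ (0 ∷ []) (values (suc k) S) φ ⟩
    ∑ (choices (values (suc k) S)) (φ ∘ (0 ∷_)) ℤ.+ 0ℤ
      ≡⟨ trans (ℤ.+-identityʳ _) (trans (∑-values-suc k S (φ ∘ (0 ∷_))) (sym (ℤ.+-identityˡ _))) ⟩
    0ℤ ℤ.+ total 0
      ≡⟨ cong₂ ℤ._+_ out-in out-out ⟨
    half outside inside ℤ.+ half outside outside ∎

values-bound : ∀ k (J : Subset n) {f} → f List.∈ choices (values k J) → ∀ {i} → i ∈ J → lookup f i < k
values-bound k J {f} f∈ {i} i∈J = List.∈-upTo⁻ (subst (lookup f i List.∈_)
  (trans (Vec.lookup-map i _ J) (cong (λ s → if s then upTo k else 0 ∷ []) (Vec.[]=⇒lookup i∈J)))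
  (∈-choices⁻ (values k J) f∈ i))

-- Translating ranges coordinate by coordinate

∑-upTo-+ : ∀ m n (φ : ℕ → ℤ) → ∑ (upTo (m + n)) φ ≡ ∑ (upTo m) φ ℤ.+ ∑ (upTo n) (λ v → φ (m + v))
∑-upTo-+ m zero    φ = trans (cong (λ k → ∑ (upTo k) φ) (ℕ.+-identityʳ m)) (sym (ℤ.+-identityʳ _))
∑-upTo-+ m (suc n) φ = begin
  ∑ (upTo (m + suc n)) φ
    ≡⟨ cong (λ k → ∑ (upTo k) φ) (ℕ.+-suc m n) ⟩
  ∑ (upTo (suc (m + n))) φ
    ≡⟨ ∑-upTo-last (m + n) φ ⟩
  ∑ (upTo (m + n)) φ ℤ.+ φ (m + n)
    ≡⟨ cong (λ z → z ℤ.+ φ (m + n)) (∑-upTo-+ m n φ) ⟩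
  ∑ (upTo m) φ ℤ.+ ∑ (upTo n) (λ v → φ (m + v)) ℤ.+ φ (m + n)
    ≡⟨ ℤ.+-assoc (∑ (upTo m) φ) _ _ ⟩
  ∑ (upTo m) φ ℤ.+ (∑ (upTo n) (λ v → φ (m + v)) ℤ.+ φ (m + n))
    ≡⟨ +-congˡ (∑ (upTo m) φ) (∑-upTo-last n (λ v → φ (m + v))) ⟨
  ∑ (upTo m) φ ℤ.+ ∑ (upTo (suc n)) (λ v → φ (m + v)) ∎
  where open ≡-Reasoning

InWindow : ℕ → ℕ → ℕ → Set
InWindow k c v = c ≤ v × v < c + k

-- Because `c ≤ r`, the range splits into `c` values below the window, the `k` values in it and
-- `r ∸ c` above it; only the middle block contributes.
∑-upTo-shift : ∀ k r c → c ≤ r → (φ : ℕ → ℤ) →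
               (∀ v → v < k + r → ¬ InWindow k c v → φ v ≡ 0ℤ) →
               ∑ (upTo (k + r)) φ ≡ ∑ (upTo k) (λ v → φ (c + v))
∑-upTo-shift k r c c≤r φ outside≡0 = begin
  ∑ (upTo (k + r)) φ
    ≡⟨ cong (λ n → ∑ (upTo n) φ) k+r≡ ⟩
  ∑ (upTo (c + (k + e))) φ
    ≡⟨ ∑-upTo-+ c (k + e) φ ⟩
  ∑ (upTo c) φ ℤ.+ ∑ (upTo (k + e)) (λ v → φ (c + v))
    ≡⟨ cong₂ ℤ._+_ left≡0 (∑-upTo-+ k e (λ v → φ (c + v))) ⟩
  0ℤ ℤ.+ (middle ℤ.+ ∑ (upTo e) (λ v → φ (c + (k + v))))
    ≡⟨ trans (ℤ.+-identityˡ _) (+-congˡ middle right≡0) ⟩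
  middle ℤ.+ 0ℤ
    ≡⟨ ℤ.+-identityʳ middle ⟩
  middle ∎
  where
  open ≡-Reasoning
  e = r ∸ c
  middle = ∑ (upTo k) (λ v → φ (c + v))
  k+r≡ : k + r ≡ c + (k + e)
  k+r≡ = trans (cong (k ℕ.+_) (sym (ℕ.m+[n∸m]≡n c≤r)))
    (trans (sym (ℕ.+-assoc k c e)) (trans (cong (ℕ._+ e) (ℕ.+-comm k c)) (ℕ.+-assoc c k e)))
  left≡0 : ∑ (upTo c) φ ≡ 0ℤ
  left≡0 = trans (∑-cong-∈ (upTo c) λ v v∈ → outside≡0 v
      (ℕ.<-≤-trans (List.∈-upTo⁻ v∈) (ℕ.≤-trans c≤r (ℕ.m≤n+m r k)))
      (λ { (c≤v , _) → ℕ.<⇒≱ (List.∈-upTo⁻ v∈) c≤v }))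
    (∑-0 (upTo c))
  right≡0 : ∑ (upTo e) (λ v → φ (c + (k + v))) ≡ 0ℤ
  right≡0 = trans (∑-cong-∈ (upTo e) λ v v∈ → outside≡0 (c + (k + v))
      (subst (c + (k + v) <_) (sym k+r≡) (ℕ.+-monoʳ-< c (ℕ.+-monoʳ-< k (List.∈-upTo⁻ v∈))))
      (λ { (_ , lt) → ℕ.<⇒≱ lt (ℕ.+-monoʳ-≤ c (ℕ.m≤m+n k v)) }))
    (∑-0 (upTo e))

choices-replicate-bound : ∀ k {f : Vec ℕ n} → f List.∈ choices (Vec.replicate n (upTo k)) → ∀ i → lookup f i < k
choices-replicate-bound {n} k {f} f∈ i = List.∈-upTo⁻ (subst (lookup f i List.∈_) (Vec.lookup-replicate i (upTo k))
  (∈-choices⁻ (Vec.replicate n (upTo k)) f∈ i))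

-- Reindexing by f ↦ c + f, each coordinate having its own offset. It turns "the weight is supported
-- in the windows" into an equality of sums; the offsets will be the ranks and the weight the
-- indicator of strict maps.
∑-choices-shift : ∀ k r (c : Vec ℕ n) → (∀ i → lookup c i ≤ r) → (φ : Vec ℕ n → ℤ) →
  (∀ f → (∀ i → lookup f i < k + r) → ¬ (∀ i → InWindow k (lookup c i) (lookup f i)) → φ f ≡ 0ℤ) →
  ∑ (choices (Vec.replicate n (upTo (k + r)))) φ ≡
  ∑ (choices (Vec.replicate n (upTo k))) (λ f → φ (Vec.zipWith _+_ c f))
∑-choices-shift k r []      c≤r φ outside≡0 = refl
∑-choices-shift {suc n} k r (c ∷ cs) c≤r φ outside≡0 = begin
  ∑ (choices (Vec.replicate (suc n) (upTo (k + r)))) φ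
    ≡⟨ ∑-choices-∷ (upTo (k + r)) (Vec.replicate n (upTo (k + r))) φ ⟩
  ∑ (upTo (k + r)) (λ v → ∑ (choices (Vec.replicate n (upTo (k + r)))) (λ f → φ (v ∷ f)))
    ≡⟨ ∑-upTo-shift k r c (c≤r zero) _ head-outside ⟩
  ∑ (upTo k) (λ v → ∑ (choices (Vec.replicate n (upTo (k + r)))) (λ f → φ (c + v ∷ f)))
    ≡⟨ ∑-cong-∈ (upTo k) (λ v v∈ → ∑-choices-shift k r cs (c≤r ∘ suc) (φ ∘ (c + v ∷_))
         λ f f< ¬all → outside≡0 (c + v ∷ f)
           (λ { zero → subst (c + v <_) (ℕ.+-comm r k) (ℕ.+-mono-≤-< (c≤r zero) (List.∈-upTo⁻ v∈)) ; (suc i) → f< i })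
           (λ all → ¬all (all ∘ suc))) ⟩
  ∑ (upTo k) (λ v → ∑ (choices (Vec.replicate n (upTo k))) (λ f → φ (c + v ∷ Vec.zipWith _+_ cs f)))
    ≡⟨ ∑-choices-∷ (upTo k) (Vec.replicate n (upTo k)) _ ⟨
  ∑ (choices (Vec.replicate (suc n) (upTo k))) (λ f → φ (Vec.zipWith _+_ (c ∷ cs) f)) ∎
  where
  open ≡-Reasoning
  head-outside : ∀ v → v < k + r → ¬ InWindow k c v →
                 ∑ (choices (Vec.replicate n (upTo (k + r)))) (λ f → φ (v ∷ f)) ≡ 0ℤ
  head-outside v v< ¬in = trans
    (∑-cong-∈ (choices (Vec.replicate n (upTo (k + r)))) λ f f∈ → outside≡0 (v ∷ f)
       (λ { zero → v< ; (suc i) → choices-replicate-bound (k + r) f∈ i }) (λ all → ¬in (all zero)))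
    (∑-0 (choices (Vec.replicate n (upTo (k + r)))))

-- Cardinalities of subsets and the pigeonhole principle

select : {P : Pred (Fin n) p} → Decidable P → Subset n
select P? = Vec.tabulate (does ∘ P?)

∈-select⁺ : {P : Pred (Fin n) p} (P? : Decidable P) {x : Fin n} → P x → x ∈ select P?
∈-select⁺ P? {x} Px = Vec.lookup⇒[]= x _ (trans (Vec.lookup∘tabulate (does ∘ P?) x) (dec-true (P? x) Px))

∈-select⁻ : {P : Pred (Fin n) p} (P? : Decidable P) {x : Fin n} → x ∈ select P? → P x
∈-select⁻ P? {x} x∈ with P? x | trans (sym (Vec.lookup∘tabulate (does ∘ P?) x)) (Vec.[]=⇒lookup x∈)
... | yes Px | _ = Px

∣p∪q∣≡∣p∣+∣q∣ : (p q : Subset n) → (∀ {x} → x ∈ p → x ∉ q) → ∣ p ∪ q ∣ ≡ ∣ p ∣ ℕ.+ ∣ q ∣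
∣p∪q∣≡∣p∣+∣q∣ []            []            disjoint = refl
∣p∪q∣≡∣p∣+∣q∣ (inside  ∷ p) (inside  ∷ q) disjoint = contradiction here (disjoint here)
∣p∪q∣≡∣p∣+∣q∣ (inside  ∷ p) (outside ∷ q) disjoint =
  cong suc (∣p∪q∣≡∣p∣+∣q∣ p q λ x∈p → disjoint (there x∈p) ∘ there)
∣p∪q∣≡∣p∣+∣q∣ (outside ∷ p) (inside  ∷ q) disjoint =
  trans (cong suc (∣p∪q∣≡∣p∣+∣q∣ p q λ x∈p → disjoint (there x∈p) ∘ there)) (sym (ℕ.+-suc ∣ p ∣ ∣ q ∣))
∣p∪q∣≡∣p∣+∣q∣ (outside ∷ p) (outside ∷ q) disjoint =
  ∣p∪q∣≡∣p∣+∣q∣ p q λ x∈p → disjoint (there x∈p) ∘ there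

-- Pigeonhole by induction on the length of the window: at most one element takes the top value
-- `c + k`, and once it is removed the rest fits into a window shorter by one.
injective⇒∣∣≤ : (D : Subset n) (g : Fin n → ℕ) → (∀ {x y} → x ∈ D → y ∈ D → g x ≡ g y → x ≡ y) →
                ∀ c k → (∀ {x} → x ∈ D → InWindow k c (g x)) → ∣ D ∣ ≤ k
injective⇒∣∣≤ {n} D g inj c zero    bound = ℕ.≤-reflexive (trans (cong ∣_∣ (Empty-unique empty)) (∣⊥∣≡0 n))
  where
  empty : ¬ (∃[ x ] x ∈ D)
  empty (x , x∈D) with c≤ , <c ← bound x∈D = ℕ.<⇒≱ (subst (g x <_) (ℕ.+-identityʳ c) <c) c≤
injective⇒∣∣≤ D g inj c (suc k) bound with any? (λ x → (x ∈? D) ×-dec (g x ℕ.≟ c + k))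
... | no none = ℕ.m≤n⇒m≤1+n (injective⇒∣∣≤ D g inj c k λ {x} x∈D → proj₁ (bound x∈D) ,
        ℕ.≤∧≢⇒< (ℕ.s≤s⁻¹ (subst (g x <_) (ℕ.+-suc c k) (proj₂ (bound x∈D)))) λ gx≡ → none (x , x∈D , gx≡))
... | yes (m , m∈D , gm≡) = begin
        ∣ D ∣                ≤⟨ p⊆q⇒∣p∣≤∣q∣ D⊆ ⟩
        ∣ ⁅ m ⁆ ∪ rest ∣     ≡⟨ ∣p∪q∣≡∣p∣+∣q∣ ⁅ m ⁆ rest (λ x∈m x∈rest → proj₂ (∈-select⁻ rest? x∈rest) (x∈⁅y⁆⇒x≡y m x∈m)) ⟩
        ∣ ⁅ m ⁆ ∣ ℕ.+ ∣ rest ∣ ≡⟨ cong (ℕ._+ ∣ rest ∣) (∣⁅x⁆∣≡1 m) ⟩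
        suc ∣ rest ∣         ≤⟨ s≤s (injective⇒∣∣≤ rest g inj′ c k bound′) ⟩
        suc k ∎
  where
  open ℕ.≤-Reasoning
  rest? : Decidable (λ x → x ∈ D × x ≢ m)
  rest? x = (x ∈? D) ×-dec ¬? (x Fin.≟ m)
  rest = select rest?
  D⊆ : D ⊆ ⁅ m ⁆ ∪ rest
  D⊆ {x} x∈D with x Fin.≟ m
  ... | yes refl = x∈p∪q⁺ (inj₁ (x∈⁅x⁆ m))
  ... | no x≢m = x∈p∪q⁺ (inj₂ (∈-select⁺ rest? (x∈D , x≢m)))
  inj′ : ∀ {x y} → x ∈ rest → y ∈ rest → g x ≡ g y → x ≡ y
  inj′ x∈ y∈ = inj (proj₁ (∈-select⁻ rest? x∈)) (proj₁ (∈-select⁻ rest? y∈))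
  bound′ : ∀ {x} → x ∈ rest → InWindow k c (g x)
  bound′ {x} x∈ with x∈D , x≢m ← ∈-select⁻ rest? x∈ = proj₁ (bound x∈D) ,
    ℕ.≤∧≢⇒< (ℕ.s≤s⁻¹ (subst (g x <_) (ℕ.+-suc c k) (proj₂ (bound x∈D)))) λ gx≡ → x≢m (inj x∈D m∈D (trans gx≡ (sym gm≡)))

-- Sign cancellation between weak and strict steps

module _ {d : ℕ} {ℓ : Level} {_⊑_ : Rel (Fin d) ℓ} (isDecPartialOrder : IsDecPartialOrder _≡_ _⊑_) where
  open IsDecPartialOrder isDecPartialOrder using (antisym; isPartialOrder)
    renaming (_≤?_ to _⊑?_; refl to ⊑-refl; trans to ⊑-trans)

  minimal : {P : Pred (Fin d) p} → Decidable P → ∀ x → P x →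
            ∃[ m ] P m × (∀ y → P y → y ⊑ m → y ≡ m)
  minimal {P = P} P? x Px = go x Px (po-wellFounded isPartialOrder x)
    where
    go : ∀ x → P x → Acc _ x → ∃[ m ] P m × (∀ y → P y → y ⊑ m → y ≡ m)
    go x Px (acc rec) with any? (λ y → P? y ×-dec ((y ⊑? x) ×-dec ¬? (y Fin.≟ x)))
    ... | yes (y , Py , y⊏x) = go y Py (rec y⊏x)
    ... | no none = x , Px , min
      where
      min : ∀ y → P y → y ⊑ x → y ≡ x
      min y Py y⊑x with y Fin.≟ x
      ... | yes y≡x = y≡x
      ... | no y≢x = contradiction (y , Py , y⊑x , y≢x) none

  -- What monotonicity of f : S → {0, …, k} requires of J = { x | f x < k } beyond
  -- monotonicity of f on J; E relates the pairs on which f may be constant.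
  Step : Rel (Fin d) 0ℓ → Rel (Subset d) ℓ
  Step E J S = J ⊆ S × (∀ x y → x ∈ S → x ∉ J → y ∈ S → x ⊑ y → y ∉ J × E x y)

  step? : {E : Rel (Fin d) 0ℓ} → Decidable₂ E → Decidable₂ (Step E)
  step? E? J S = (J ⊆? S) ×-dec all? λ x → all? λ y →
    (x ∈? S) →-dec (¬? (x ∈? J) →-dec ((y ∈? S) →-dec ((x ⊑? y) →-dec (¬? (y ∈? J) ×-dec E? x y))))

  Always : Rel (Fin d) 0ℓ
  Always _ _ = Unit

  always? : Decidable₂ Always
  always? _ _ = yes tt

  weakStep? : Decidable₂ (Step Always)
  weakStep? = step? always?

  strictStep? : Decidable₂ (Step _≡_)
  strictStep? = step? Fin._≟_

  module _ (K S : Subset d) where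

    -- The middle sets of a strict step from `K` followed by a weak step to `S`: `J` is a down-set
    -- of `S`, and `J` minus `K` consists of maximal elements of `J`.
    Between : Subset d → Set ℓ
    Between J = Step Always J S × Step _≡_ K J

    between? : Decidable Between
    between? J = weakStep? J S ×-dec strictStep? K J

    module _ {m : Fin d} (m∈S : m ∈ S) (m∉K : m ∉ K)
             (min : ∀ y → y ∈ S × y ∉ K → y ⊑ m → y ≡ m) where

      -- Removing `m` keeps `J` a down-set of `S`, since `m` is a maximal element of `J`. Adding `m`
      -- does so because whatever lies strictly below `m` in `S` belongs to `K`, by minimality. The
      -- added `m` is maximal: a point of `J` above it would force `m` into the down-set `J`.
      between-toggle : ∀ J → Between J → Between (toggle m J)
      between-toggle J ((J⊆S , down) , (K⊆J , maxl)) with m ∈? J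
      ... | yes m∈J = (J′⊆S , down′) , (K⊆J′ , maxl′)
        where
        ≢m : ∀ {x} → x ∈ toggle m J → x ≢ m
        ≢m x∈J′ refl = ∉-toggle m∈J x∈J′
        ⊆J : ∀ {x} → x ∈ toggle m J → x ∈ J
        ⊆J x∈J′ = ∈-toggle⁻ (≢m x∈J′) x∈J′
        J′⊆S : toggle m J ⊆ S
        J′⊆S = J⊆S ∘ ⊆J
        K⊆J′ : K ⊆ toggle m J
        K⊆J′ {x} x∈K = ∈-toggle⁺ (λ { refl → m∉K x∈K }) (K⊆J x∈K)
        down′ : ∀ x y → x ∈ S → x ∉ toggle m J → y ∈ S → x ⊑ y → y ∉ toggle m J × Unit
        down′ x y x∈S x∉J′ y∈S x⊑y with x Fin.≟ m
        ... | yes refl = (λ y∈J′ → ≢m y∈J′ (sym (proj₂ (maxl m y m∈J m∉K (⊆J y∈J′) x⊑y)))) , tt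
        ... | no x≢m = (λ y∈J′ → proj₁ (down x y x∈S (x∉J′ ∘ ∈-toggle⁺ x≢m) y∈S x⊑y) (⊆J y∈J′)) , tt
        maxl′ : ∀ x y → x ∈ toggle m J → x ∉ K → y ∈ toggle m J → x ⊑ y → y ∉ K × x ≡ y
        maxl′ x y x∈J′ x∉K y∈J′ = maxl x y (⊆J x∈J′) x∉K (⊆J y∈J′)
      ... | no m∉J = (J′⊆S , down′) , (K⊆J′ , maxl′)
        where
        J⊆J′ : J ⊆ toggle m J
        J⊆J′ {x} x∈J = ∈-toggle⁺ (λ { refl → m∉J x∈J }) x∈J
        J′⊆S : toggle m J ⊆ S
        J′⊆S {x} x∈J′ with x Fin.≟ m
        ... | yes refl = m∈S
        ... | no x≢m = J⊆S (∈-toggle⁻ x≢m x∈J′)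
        K⊆J′ : K ⊆ toggle m J
        K⊆J′ = J⊆J′ ∘ K⊆J
        down′ : ∀ x y → x ∈ S → x ∉ toggle m J → y ∈ S → x ⊑ y → y ∉ toggle m J × Unit
        down′ x y x∈S x∉J′ y∈S x⊑y with y Fin.≟ m
        ... | yes refl = contradiction (subst (_∈ toggle m J) (sym x≡m) (∈-toggle m∉J)) x∉J′
          where x≡m = min x (x∈S , x∉J′ ∘ K⊆J′) x⊑y
        ... | no y≢m = (λ y∈J′ → proj₁ (down x y x∈S (x∉J′ ∘ J⊆J′) y∈S x⊑y) (∈-toggle⁻ y≢m y∈J′)) , tt
        maxl′ : ∀ x y → x ∈ toggle m J → x ∉ K → y ∈ toggle m J → x ⊑ y → y ∉ K × x ≡ y
        maxl′ x y x∈J′ x∉K y∈J′ x⊑y with x Fin.≟ m | y Fin.≟ m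
        ... | yes refl | yes refl = m∉K , refl
        ... | yes refl | no y≢m = contradiction (∈-toggle⁻ y≢m y∈J′) (proj₁ (down x y m∈S m∉J (J′⊆S y∈J′) x⊑y))
        ... | no x≢m | yes refl = m∉K , min x (J′⊆S x∈J′ , x∉K) x⊑y
        ... | no x≢m | no y≢m = maxl x y (∈-toggle⁻ x≢m x∈J′) x∉K (∈-toggle⁻ y≢m y∈J′) x⊑y

    -- Up to signs, the matrices of weak and strict steps are inverse to each other; this is the
    -- combinatorial core of reciprocity. If `S` has a point outside `K`, toggling a minimal such
    -- point cancels everything; otherwise K ⊆ J ⊆ S ⊆ K leaves only `J = S = K`.
    ∑-between : ∑ (subsets d) (λ J → sgn J * 𝟙 (between? J)) ≡ sgn S * 𝟙 (K ≟ S)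
    ∑-between with any? (λ x → (x ∈? S) ×-dec ¬? (x ∈? K))
    ... | yes (x , x∈S , x∉K) = trans (∑-toggle-odd m _ odd) (sym (trans
            (cong (sgn S *_) (𝟙-no (K ≟ S) λ { refl → m∉K m∈S })) (ℤ.*-zeroʳ (sgn S))))
      where
      found = minimal (λ x → (x ∈? S) ×-dec ¬? (x ∈? K)) x (x∈S , x∉K)
      m = proj₁ found
      m∈S = proj₁ (proj₁ (proj₂ found))
      m∉K = proj₂ (proj₁ (proj₂ found))
      t = between-toggle m∈S m∉K (proj₂ (proj₂ found))
      odd : ∀ J → sgn (toggle m J) * 𝟙 (between? (toggle m J)) ≡ - (sgn J * 𝟙 (between? J))
      odd J = trans
        (cong₂ _*_ (sgn-toggle m J)
          (𝟙-cong (between? (toggle m J)) (between? J)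
            (subst Between (toggle-involutive m J) ∘ t (toggle m J)) (t J)))
        (sym (ℤ.neg-distribˡ-* (sgn J) _))
    ... | no none = trans (∑-cong (subsets d) pinned) (∑-δ S _)
      where
      S⊆K : S ⊆ K
      S⊆K {x} x∈S with x ∈? K
      ... | yes x∈K = x∈K
      ... | no x∉K = contradiction (x , x∈S , x∉K) none
      to : ∀ {J} → Between J → J ≡ S × K ≡ S
      to ((J⊆S , _) , (K⊆J , _)) = ⊆-antisym J⊆S (K⊆J ∘ S⊆K) , ⊆-antisym (J⊆S ∘ K⊆J) S⊆K
      from : ∀ {J} → J ≡ S × K ≡ S → Between J
      from (refl , refl) = (id , λ x y x∈S x∉S → contradiction x∈S x∉S)
                         , (id , λ x y x∈S x∉S → contradiction x∈S x∉S)
      open ≡-Reasoning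
      pinned : ∀ J → sgn J * 𝟙 (between? J) ≡ 𝟙 (J ≟ S) * (sgn J * 𝟙 (K ≟ S))
      pinned J = begin
        sgn J * 𝟙 (between? J)
          ≡⟨ cong (sgn J *_) (trans (𝟙-cong (between? J) ((J ≟ S) ×-dec (K ≟ S)) to from) (𝟙-× (J ≟ S) (K ≟ S))) ⟩
        sgn J * (𝟙 (J ≟ S) * 𝟙 (K ≟ S))
          ≡⟨ rearrange (sgn J) (𝟙 (J ≟ S)) _ ⟩
        𝟙 (J ≟ S) * (sgn J * 𝟙 (K ≟ S)) ∎
        where rearrange : ∀ x y z → x * (y * z) ≡ y * (x * z)
              rearrange = solve-∀

  -- The order function at all integers

  -- Transfer-matrix form: sequences of `k` steps from the empty set to `S`, the i-th set holding
  -- the points of value below i. The recursion is thus definitional, and `count≡∑monotone` makes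
  -- the link with maps.
  count : {E : Rel (Fin d) 0ℓ} → Decidable₂ E → ℕ → Subset d → ℤ
  count E? zero    S = 𝟙 (S ≟ ⊥)
  count E? (suc k) S = ∑ (subsets d) (λ J → 𝟙 (step? E? J S) * count E? k J)

  weakCount strictCount : ℕ → Subset d → ℤ
  weakCount   = count always?
  strictCount = count Fin._≟_

  orderFunction : Subset d → ℤ → ℤ
  orderFunction S (+ k)     = weakCount k S
  orderFunction S -[1+ k ]  = sgn S * strictCount (suc k) S

  -- The two clauses of `orderFunction` fit together at 0: both counts are the indicator of the
  -- empty set, which has sign 1. This lets the recursion cross from -1 to 0.
  orderFunction-neg : ∀ S k → orderFunction S (- + k) ≡ sgn S * strictCount k S
  orderFunction-neg S (suc k) = refl
  orderFunction-neg S zero with S ≟ ⊥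
  ... | yes refl = trans (cong (-1ℤ ^_) (sym (∣⊥∣≡0 d))) (sym (ℤ.*-identityʳ (sgn S)))
  ... | no _ = sym (ℤ.*-zeroʳ (sgn S))

  -- For nonnegative `z` this is the definition of `count`. For negative `z`, one strict step is
  -- expanded in each summand; after exchanging the sums, `J` runs between `K` and `S`, and
  -- `∑-between` leaves only `K = S`.
  orderFunction-suc : ∀ S z → orderFunction S (ℤ.suc z) ≡
    ∑ (subsets d) (λ J → 𝟙 (weakStep? J S) * orderFunction J z)
  orderFunction-suc S (+ k)    = refl
  orderFunction-suc S -[1+ k ] = sym (begin
    ∑ (subsets d) (λ J → 𝟙 (weak J S) * (sgn J * ∑ (subsets d) (λ K → 𝟙 (strict K J) * strictCount k K)))
      ≡⟨ ∑-cong (subsets d) (λ J → trans (sym (ℤ.*-assoc (𝟙 (weak J S)) (sgn J) _))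
           (trans (sym (∑-*ˡ (subsets d) (𝟙 (weak J S) * sgn J) _))
             (∑-cong (subsets d) λ K → trans
               (rearrange (𝟙 (weak J S)) (sgn J) (𝟙 (strict K J)) (strictCount k K))
               (cong (λ i → strictCount k K * (sgn J * i)) (sym (𝟙-× (weak J S) (strict K J))))))) ⟩
    ∑ (subsets d) (λ J → ∑ (subsets d) (λ K → strictCount k K * (sgn J * 𝟙 (between? K S J))))
      ≡⟨ ∑-swap (subsets d) (subsets d) _ ⟩
    ∑ (subsets d) (λ K → ∑ (subsets d) (λ J → strictCount k K * (sgn J * 𝟙 (between? K S J))))
      ≡⟨ ∑-cong (subsets d) (λ K → trans (∑-*ˡ (subsets d) (strictCount k K) _)
           (trans (cong (strictCount k K *_) (∑-between K S))
                  (rotate (strictCount k K) (sgn S) (𝟙 (K ≟ S))))) ⟩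
    ∑ (subsets d) (λ K → 𝟙 (K ≟ S) * (sgn S * strictCount k K))
      ≡⟨ ∑-δ S (λ K → sgn S * strictCount k K) ⟩
    sgn S * strictCount k S
      ≡⟨ orderFunction-neg S k ⟨
    orderFunction S (- + k)
      ≡⟨ cong (orderFunction S) (suc-neg k) ⟩
    orderFunction S (ℤ.suc -[1+ k ]) ∎)
    where
    open ≡-Reasoning
    weak = weakStep?
    strict = strictStep?
    rearrange : ∀ w s b t → w * s * (b * t) ≡ t * (s * (w * b))
    rearrange = solve-∀
    rotate : ∀ t s i → t * (s * i) ≡ i * (s * t)
    rotate = solve-∀
    suc-neg : ∀ k → - + k ≡ ℤ.suc -[1+ k ]
    suc-neg zero    = refl
    suc-neg (suc k) = refl

  ⊆∧≢⇒∣∣< : {J S : Subset d} → J ⊆ S → J ≢ S → ∣ J ∣ < ∣ S ∣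
  ⊆∧≢⇒∣∣< {J} {S} J⊆S J≢S with any? (λ x → (x ∈? S) ×-dec ¬? (x ∈? J))
  ... | yes new = p⊂q⇒∣p∣<∣q∣ (J⊆S , new)
  ... | no none = contradiction (⊆-antisym J⊆S S⊆J) J≢S
    where
    S⊆J : S ⊆ J
    S⊆J {x} x∈S with x ∈? J
    ... | yes x∈J = x∈J
    ... | no x∉J = contradiction (x , x∈S , x∉J) none

  -- Vanishing of high differences

  -- The values of orderFunction S at -M, -M + 1, …
  window : ℕ → Subset d → ℕ → ℤ
  window M S t = orderFunction S (t ⊖ M)

  -- Writing the subtracted value as a delta sum over the same subsets gives `J = S` the coefficient
  -- 1 - 1, so only proper down-sets of `S` survive.
  window-suc : ∀ M S t → window M S (suc t) - window M S t ≡
    ∑ (subsets d) (λ J → (𝟙 (weakStep? J S) - 𝟙 (J ≟ S)) * window M J t)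
  window-suc M S t = begin
    orderFunction S (suc t ⊖ M) - window M S t
      ≡⟨ cong (λ z → orderFunction S z - window M S t) (sym (ℤ.distribʳ-⊖-+-pos 1 t M)) ⟩
    orderFunction S (ℤ.suc (t ⊖ M)) - window M S t
      ≡⟨ cong₂ _-_ (orderFunction-suc S (t ⊖ M)) (sym (∑-δ S (λ J → window M J t))) ⟩
    ∑ (subsets d) (λ J → 𝟙 (weak J S) * window M J t) - ∑ (subsets d) (λ J → 𝟙 (J ≟ S) * window M J t)
      ≡⟨ cong (λ z → ∑ (subsets d) (λ J → 𝟙 (weak J S) * window M J t) ℤ.+ z) (sym (∑-neg (subsets d) _)) ⟩
    ∑ (subsets d) (λ J → 𝟙 (weak J S) * window M J t) ℤ.+ ∑ (subsets d) (λ J → - (𝟙 (J ≟ S) * window M J t))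
      ≡⟨ sym (∑-+ (subsets d) _ _) ⟩
    ∑ (subsets d) (λ J → 𝟙 (weak J S) * window M J t - 𝟙 (J ≟ S) * window M J t)
      ≡⟨ ∑-cong (subsets d) (λ J → factor (𝟙 (weak J S)) (𝟙 (J ≟ S)) (window M J t)) ⟩
    ∑ (subsets d) (λ J → (𝟙 (weak J S) - 𝟙 (J ≟ S)) * window M J t) ∎
    where
    open ≡-Reasoning
    weak = weakStep?
    factor : ∀ c d x → c * x - d * x ≡ (c - d) * x
    factor = solve-∀

  -- A degree bound by induction on `n`: a unit difference leaves only windows of smaller subsets,
  -- and `Δ^-coarsen` trades the unit step for step `a`. The strict bound makes `n = 0` void.
  Δ^-window : ∀ a M n S → ∣ S ∣ < n → ∀ t → Δ^ a n (window M S) t ≡ 0ℤ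
  Δ^-window a M (suc n) S ∣S∣<1+n = Δ^-coarsen a n (window M S) vanish a
    where
    weak = weakStep?
    term : ∀ t J → Δ^ a n (λ t → (𝟙 (weak J S) - 𝟙 (J ≟ S)) * window M J t) t ≡ 0ℤ
    term t J = trans (Δ^-* a n (𝟙 (weak J S) - 𝟙 (J ≟ S)) (window M J) t) vanishes
      where
      vanishes : (𝟙 (weak J S) - 𝟙 (J ≟ S)) * Δ^ a n (window M J) t ≡ 0ℤ
      vanishes with J ≟ S
      ... | yes refl = cong (λ i → (i - 1ℤ) * Δ^ a n (window M J) t)
                         (𝟙-yes (weak J S) (id , λ x y x∈S x∉S → contradiction x∈S x∉S))
      ... | no J≢S with weak J S
      ... | no _ = refl
      ... | yes (J⊆S , _) = cong (1ℤ *_)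
              (Δ^-window a M n J (ℕ.<-≤-trans (⊆∧≢⇒∣∣< J⊆S J≢S) (ℕ.s≤s⁻¹ ∣S∣<1+n)) t)
    vanish : ∀ t → Δ^ a n (λ t → window M S (suc t) - window M S t) t ≡ 0ℤ
    vanish t = trans (Δ^-cong a n (window-suc M S) t)
      (trans (Δ^-∑ a n (subsets d) _ t) (∑-zero (subsets d) (term t)))

  -- Counting monotone maps by steps

  -- E = Always gives weakly monotone maps, E = _≡_ strictly monotone ones.
  Monotone : Rel (Fin d) 0ℓ → Subset d → Vec ℕ d → Set ℓ
  Monotone E S f = ∀ x y → x ∈ S → y ∈ S → x ⊑ y → lookup f x < lookup f y ⊎ (lookup f x ≡ lookup f y × E x y)

  monotone? : {E : Rel (Fin d) 0ℓ} → Decidable₂ E → Decidable₂ (Monotone E)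
  monotone? E? S f = all? λ x → all? λ y → (x ∈? S) →-dec ((y ∈? S) →-dec ((x ⊑? y) →-dec
    ((lookup f x ℕ.<? lookup f y) ⊎-dec ((lookup f x ℕ.≟ lookup f y) ×-dec E? x y))))

  module _ {E : Rel (Fin d) 0ℓ} (E? : Decidable₂ E) {k : ℕ} {S J : Subset d} (f : Vec ℕ d)
           (J⊆S : J ⊆ S) (f<k : ∀ {i} → i ∈ J → lookup f i < k) where

    private
      on-J : ∀ {i} → i ∈ J → lookup (extend k S J f) i ≡ lookup f i
      on-J = lookup-extend-∈ k S J f
      off-J : ∀ {i} → i ∈ S → i ∉ J → lookup (extend k S J f) i ≡ k
      off-J = lookup-extend-∉ k S J f

    -- Values on `J` are below `k` and those on the rest of `S` equal `k`. A relation from the rest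
    -- into `J` would decrease, one within the rest is a tie and needs `E`, and one from `J` to the
    -- rest increases by itself; `Step` records exactly the first two.
    monotone-extend⁻ : Monotone E S (extend k S J f) → Step E J S × Monotone E J f
    monotone-extend⁻ mono = (J⊆S , step) , restrict
      where
      restrict : Monotone E J f
      restrict x y x∈J y∈J x⊑y with mono x y (J⊆S x∈J) (J⊆S y∈J) x⊑y
      ... | r rewrite on-J x∈J | on-J y∈J = r
      step : ∀ x y → x ∈ S → x ∉ J → y ∈ S → x ⊑ y → y ∉ J × E x y
      step x y x∈S x∉J y∈S x⊑y with y ∈? J | mono x y x∈S y∈S x⊑y
      ... | yes y∈J | r rewrite off-J x∈S x∉J | on-J y∈J with r
      ...   | inj₁ k<fy       = contradiction k<fy (ℕ.<-asym (f<k y∈J))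
      ...   | inj₂ (k≡fy , _) = contradiction (sym k≡fy) (ℕ.<⇒≢ (f<k y∈J))
      step x y x∈S x∉J y∈S x⊑y | no y∉J | r rewrite off-J x∈S x∉J | off-J y∈S y∉J with r
      ...   | inj₁ k<k        = contradiction k<k (ℕ.<-irrefl refl)
      ...   | inj₂ (_ , Exy)  = y∉J , Exy

    monotone-extend⁺ : Step E J S → Monotone E J f → Monotone E S (extend k S J f)
    monotone-extend⁺ (_ , step) mono x y x∈S y∈S x⊑y with x ∈? J | y ∈? J
    ... | yes x∈J | yes y∈J rewrite on-J x∈J | on-J y∈J = mono x y x∈J y∈J x⊑y
    ... | yes x∈J | no  y∉J rewrite on-J x∈J | off-J y∈S y∉J = inj₁ (f<k x∈J)
    ... | no  x∉J | _ with y∉J , Exy ← step x y x∈S x∉J y∈S x⊑y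
                      rewrite off-J x∈S x∉J | off-J y∈S y∉J = inj₂ (refl , Exy)

  -- Both sides obey the same recursion: `∑-values-suc` cuts off the points of top value, and the
  -- extension is monotone exactly when the cut is a step and the restriction is monotone.
  count≡∑monotone : {E : Rel (Fin d) 0ℓ} (E? : Decidable₂ E) → ∀ k S →
    count E? k S ≡ ∑ (choices (values k S)) (λ f → 𝟙 (monotone? E? S f))
  count≡∑monotone E? zero S = sym (trans (∑-values-zero S _) nonempty)
    where
    nonempty : 𝟙 (S ≟ ⊥) * 𝟙 (monotone? E? S (Vec.replicate d 0)) ≡ 𝟙 (S ≟ ⊥)
    nonempty with S ≟ ⊥
    ... | no _ = refl
    ... | yes refl = cong (1ℤ *_) (𝟙-yes (monotone? E? ⊥ (Vec.replicate d 0)) λ x y x∈⊥ → contradiction x∈⊥ ∉⊥)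
  count≡∑monotone E? (suc k) S = sym (trans (∑-values-suc k S _) (∑-cong (subsets d) term))
    where
    term : ∀ J → 𝟙 (J ⊆? S) * ∑ (choices (values k J)) (λ f → 𝟙 (monotone? E? S (extend k S J f))) ≡
                 𝟙 (step? E? J S) * count E? k J
    term J = by (J ⊆? S)
      where
      by : (J⊆?S : Dec (J ⊆ S)) →
           𝟙 J⊆?S * ∑ (choices (values k J)) (λ f → 𝟙 (monotone? E? S (extend k S J f))) ≡
           𝟙 (step? E? J S) * count E? k J
      by (no J⊈S) = sym (cong (_* count E? k J)
                     (𝟙-no (step? E? J S) λ step → J⊈S (proj₁ step)))
      by (yes J⊆S) = trans (ℤ.*-identityˡ _) (trans
            -- The bound by `k` on `J` holds only for vectors from the list, so the congruence must
            -- use membership.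
            (∑-cong-∈ (choices (values k J)) λ f f∈ → trans
              (𝟙-cong (monotone? E? S (extend k S J f)) (step? E? J S ×-dec monotone? E? J f)
                (monotone-extend⁻ E? f J⊆S (values-bound k J f∈))
                (λ { (step , mono) → monotone-extend⁺ E? f J⊆S (values-bound k J f∈) step mono }))
              (𝟙-× (step? E? J S) (monotone? E? J f)))
            (trans (∑-*ˡ (choices (values k J)) (𝟙 (step? E? J S)) _)
                   (cong (𝟙 (step? E? J S) *_) (sym (count≡∑monotone E? k J)))))

  -- Chains and maximal chains

  Comparable : Rel (Fin d) ℓ
  Comparable x y = x ⊑ y ⊎ y ⊑ x

  comparable? : Decidable₂ Comparable
  comparable? x y = (x ⊑? y) ⊎-dec (y ⊑? x)

  Chain : Subset d → Set ℓ
  Chain C = ∀ x y → x ∈ C → y ∈ C → Comparable x y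

  MaximalChain : Subset d → Set ℓ
  MaximalChain C = Chain C × (∀ D → Chain D → C ⊆ D → D ⊆ C)

  Graded : ℕ → Set ℓ
  Graded r = ∀ C → MaximalChain C → ∣ C ∣ ≡ suc r

  chain-insert : ∀ {C} z → Chain C → (∀ x → x ∈ C → Comparable z x) → Chain (C ∪ ⁅ z ⁆)
  chain-insert {C} z chain cmp x y x∈ y∈ with x∈p∪q⁻ C ⁅ z ⁆ x∈ | x∈p∪q⁻ C ⁅ z ⁆ y∈
  ... | inj₁ x∈C | inj₁ y∈C = chain x y x∈C y∈C
  ... | inj₁ x∈C | inj₂ y∈z rewrite x∈⁅y⁆⇒x≡y z y∈z = Sum.swap (cmp x x∈C)
  ... | inj₂ x∈z | inj₁ y∈C rewrite x∈⁅y⁆⇒x≡y z x∈z = cmp y y∈C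
  ... | inj₂ x∈z | inj₂ y∈z rewrite x∈⁅y⁆⇒x≡y z x∈z | x∈⁅y⁆⇒x≡y z y∈z = inj₁ ⊑-refl

  maximal-absorbs : ∀ {C} → MaximalChain C → ∀ z → (∀ x → x ∈ C → Comparable z x) → z ∈ C
  maximal-absorbs {C} (chain , max) z cmp =
    max (C ∪ ⁅ z ⁆) (chain-insert z chain cmp) (p⊆p∪q ⁅ z ⁆) (q⊆p∪q C ⁅ z ⁆ (x∈⁅x⁆ z))

  -- Greedy: a point comparable with the whole chain is adjoined until none is left. This ends
  -- because the subsets are finite.
  extendChain : ∀ C → Chain C → ∃[ D ] C ⊆ D × MaximalChain D
  extendChain C chain = go C chain (⊃-wellFounded C)
    where
    go : ∀ C → Chain C → Acc _⊃_ C → ∃[ D ] C ⊆ D × MaximalChain D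
    go C chain (acc rec) with any? (λ z → ¬? (z ∈? C) ×-dec all? λ x → (x ∈? C) →-dec comparable? z x)
    ... | no none = C , id , chain , max
      where
      max : ∀ D → Chain D → C ⊆ D → D ⊆ C
      max D chainD C⊆D {z} z∈D with z ∈? C
      ... | yes z∈C = z∈C
      ... | no z∉C = contradiction (z , z∉C , λ x x∈C → chainD z x z∈D (C⊆D x∈C)) none
    ... | yes (z , z∉C , cmp)
      with D , C′⊆D , max ← go (C ∪ ⁅ z ⁆) (chain-insert z chain cmp)
                              (rec (p⊆p∪q ⁅ z ⁆ , z , q⊆p∪q C ⁅ z ⁆ (x∈⁅x⁆ z) , z∉C))
      = D , C′⊆D ∘ p⊆p∪q ⁅ z ⁆ , max

  chain-⁅⁆ : ∀ x → Chain ⁅ x ⁆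
  chain-⁅⁆ x y z y∈ z∈ rewrite x∈⁅y⁆⇒x≡y x y∈ | x∈⁅y⁆⇒x≡y x z∈ = inj₁ ⊑-refl

  through : ∀ x y → x ⊑ y → ∃[ C ] MaximalChain C × x ∈ C × y ∈ C
  through x y x⊑y
    with C , pair⊆C , max ← extendChain (⁅ x ⁆ ∪ ⁅ y ⁆) (chain-insert y (chain-⁅⁆ x)
           λ z z∈x → inj₂ (subst (_⊑ y) (sym (x∈⁅y⁆⇒x≡y x z∈x)) x⊑y))
    = C , max , pair⊆C (x∈p∪q⁺ (inj₁ (x∈⁅x⁆ x))) , pair⊆C (x∈p∪q⁺ (inj₂ (x∈⁅x⁆ y)))

  -- Strict here and weak in `above?`, so that the two parts of a chain through `x` are disjoint and
  -- `x` is counted once; the size of the lower part is then the rank of `x`.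
  below? : ∀ C x → Decidable (λ z → z ∈ C × z ⊑ x × z ≢ x)
  below? C x z = (z ∈? C) ×-dec ((z ⊑? x) ×-dec ¬? (z Fin.≟ x))

  above? : ∀ C x → Decidable (λ z → z ∈ C × x ⊑ z)
  above? C x z = (z ∈? C) ×-dec (x ⊑? z)

  below above : Subset d → Fin d → Subset d
  below C x = select (below? C x)
  above C x = select (above? C x)

  -- A point above `x` that extends the splice is comparable with all of `D`, its part below `x`
  -- included by transitivity, so it lies in `D` by maximality. Dually, a point below `x` lies in
  -- `C`.
  splice-maximal : ∀ {C D x} → MaximalChain C → MaximalChain D → x ∈ C → x ∈ D →
                   MaximalChain (below C x ∪ above D x)
  splice-maximal {C} {D} {x} maxC@(chainC , _) maxD@(chainD , _) x∈C x∈D = chain , max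
    where
    E = below C x ∪ above D x
    chain : Chain E
    chain a b a∈ b∈ with x∈p∪q⁻ (below C x) (above D x) a∈ | x∈p∪q⁻ (below C x) (above D x) b∈
    ... | inj₁ a∈C | inj₁ b∈C = chainC a b (proj₁ (∈-select⁻ (below? C x) a∈C)) (proj₁ (∈-select⁻ (below? C x) b∈C))
    ... | inj₂ a∈D | inj₂ b∈D = chainD a b (proj₁ (∈-select⁻ (above? D x) a∈D)) (proj₁ (∈-select⁻ (above? D x) b∈D))
    ... | inj₁ a∈C | inj₂ b∈D = inj₁ (⊑-trans (proj₁ (proj₂ (∈-select⁻ (below? C x) a∈C))) (proj₂ (∈-select⁻ (above? D x) b∈D)))
    ... | inj₂ a∈D | inj₁ b∈C = inj₂ (⊑-trans (proj₁ (proj₂ (∈-select⁻ (below? C x) b∈C))) (proj₂ (∈-select⁻ (above? D x) a∈D)))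
    x∈E : x ∈ E
    x∈E = x∈p∪q⁺ (inj₂ (∈-select⁺ (above? D x) (x∈D , ⊑-refl)))
    max : ∀ F → Chain F → E ⊆ F → F ⊆ E
    max F chainF E⊆F {z} z∈F with x ⊑? z
    ... | yes x⊑z = x∈p∪q⁺ (inj₂ (∈-select⁺ (above? D x) (maximal-absorbs maxD z cmp , x⊑z)))
      where
      cmp : ∀ w → w ∈ D → Comparable z w
      cmp w w∈D with chainD x w x∈D w∈D
      ... | inj₁ x⊑w = chainF z w z∈F (E⊆F (x∈p∪q⁺ (inj₂ (∈-select⁺ (above? D x) (w∈D , x⊑w)))))
      ... | inj₂ w⊑x = inj₂ (⊑-trans w⊑x x⊑z)
    ... | no x⋢z with chainF x z (E⊆F x∈E) z∈F
    ... | inj₁ x⊑z = contradiction x⊑z x⋢z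
    ... | inj₂ z⊑x = x∈p∪q⁺ (inj₁ (∈-select⁺ (below? C x) (maximal-absorbs maxC z cmp , z⊑x , λ { refl → x⋢z ⊑-refl })))
      where
      cmp : ∀ w → w ∈ C → Comparable z w
      cmp w w∈C with w Fin.≟ x | chainC x w x∈C w∈C
      ... | yes refl | _ = inj₁ z⊑x
      ... | no  w≢x | inj₁ x⊑w = inj₁ (⊑-trans z⊑x x⊑w)
      ... | no  w≢x | inj₂ w⊑x = chainF z w z∈F (E⊆F (x∈p∪q⁺ (inj₁ (∈-select⁺ (below? C x) (w∈C , w⊑x , w≢x)))))

  -- The rank function of a graded poset

  module _ {r : ℕ} (graded : Graded r) where

    ∣below∣+∣above∣ : ∀ {C D x} → MaximalChain C → MaximalChain D → x ∈ C → x ∈ D →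
                      ∣ below C x ∣ ℕ.+ ∣ above D x ∣ ≡ suc r
    ∣below∣+∣above∣ {C} {D} {x} maxC maxD x∈C x∈D = trans
      (sym (∣p∪q∣≡∣p∣+∣q∣ (below C x) (above D x) disjoint))
      (graded _ (splice-maximal maxC maxD x∈C x∈D))
      where
      disjoint : ∀ {z} → z ∈ below C x → z ∉ above D x
      disjoint z∈b z∈a with _ , z⊑x , z≢x ← ∈-select⁻ (below? C x) z∈b | _ , x⊑z ← ∈-select⁻ (above? D x) z∈a =
        z≢x (antisym z⊑x x⊑z)

    rank : Fin d → ℕ
    rank x = ∣ below (proj₁ (through x x ⊑-refl)) x ∣

    -- The chosen chain does not matter: the lower parts of both chains complete the same upper part
    -- `above C x` to a maximal chain, which has r + 1 elements in either case.
    ∣below∣≡rank : ∀ {C x} → MaximalChain C → x ∈ C → ∣ below C x ∣ ≡ rank x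
    ∣below∣≡rank {C} {x} maxC x∈C = let (D , maxD , x∈D , _) = through x x ⊑-refl in
      ℕ.+-cancelʳ-≡ ∣ above C x ∣ _ _
        (trans (∣below∣+∣above∣ maxC maxC x∈C x∈C) (sym (∣below∣+∣above∣ maxD maxC x∈D x∈C)))

    rank-strict : ∀ {x y} → x ⊑ y → x ≢ y → rank x < rank y
    rank-strict {x} {y} x⊑y x≢y with C , max , x∈C , y∈C ← through x y x⊑y =
      subst₂ _<_ (∣below∣≡rank max x∈C) (∣below∣≡rank max y∈C) (p⊂q⇒∣p∣<∣q∣ (sub , x ,
        ∈-select⁺ (below? C y) (x∈C , x⊑y , x≢y) , λ x∈ → proj₂ (proj₂ (∈-select⁻ (below? C x) x∈)) refl))
      where
      sub : below C x ⊆ below C y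
      sub z∈ with z∈C , z⊑x , z≢x ← ∈-select⁻ (below? C x) z∈ =
        ∈-select⁺ (below? C y) (z∈C , ⊑-trans z⊑x x⊑y , λ { refl → x≢y (antisym x⊑y z⊑x) })

    rank≤r : ∀ x → rank x ≤ r
    rank≤r x = let (C , max , x∈C , _) = through x x ⊑-refl in
      ℕ.s≤s⁻¹ (subst (∣ below C x ∣ <_) (graded C max) (p⊂q⇒∣p∣<∣q∣
        (proj₁ ∘ ∈-select⁻ (below? C x) , x , x∈C , λ x∈ → proj₂ (proj₂ (∈-select⁻ (below? C x) x∈)) refl)))

    -- Strict functions compared with the rank

    module _ (g : Fin d → ℕ) (g-strict : ∀ {x y} → x ⊑ y → x ≢ y → g x < g y) where

      g-mono : ∀ {x y} → x ⊑ y → g x ≤ g y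
      g-mono {x} {y} x⊑y with x Fin.≟ y
      ... | yes refl = ℕ.≤-refl
      ... | no x≢y = ℕ.<⇒≤ (g-strict x⊑y x≢y)

      g-injective : ∀ {C} → Chain C → ∀ {x y} → x ∈ C → y ∈ C → g x ≡ g y → x ≡ y
      g-injective chain {x} {y} x∈C y∈C gx≡gy with x Fin.≟ y | chain x y x∈C y∈C
      ... | yes x≡y | _ = x≡y
      ... | no x≢y | inj₁ x⊑y = contradiction gx≡gy (ℕ.<⇒≢ (g-strict x⊑y x≢y))
      ... | no x≢y | inj₂ y⊑x = contradiction (sym gx≡gy) (ℕ.<⇒≢ (g-strict y⊑x (x≢y ∘ sym)))

      -- The rank counts chain elements strictly below `x`, and their `g`-values are distinct
      -- elements of [0, g x).
      rank≤g : ∀ x → rank x ≤ g x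
      rank≤g x = let (C , max , _) = through x x ⊑-refl in injective⇒∣∣≤ (below C x) g
        (λ y∈ z∈ → g-injective (proj₁ max) (proj₁ (∈-select⁻ (below? C x) y∈)) (proj₁ (∈-select⁻ (below? C x) z∈)))
        0 (g x) (λ y∈ → z≤n , let (_ , y⊑x , y≢x) = ∈-select⁻ (below? C x) y∈ in g-strict y⊑x y≢x)

      -- Dual to `rank≤g`: the r + 1 - rank x chain elements from `x` upwards have distinct values
      -- in [g x, k + r).
      g<rank+k : ∀ k → (∀ x → g x < k + r) → ∀ x → g x < rank x + k
      g<rank+k k g< x = ℕ.+-cancelʳ-≤ r (suc (g x)) (∣ below C x ∣ ℕ.+ k) (begin
        suc (g x) + r                                       ≡⟨ ℕ.+-suc (g x) r ⟨
        g x + suc r                                         ≡⟨ cong (g x ℕ.+_) (∣below∣+∣above∣ max max x∈C x∈C) ⟨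
        g x + (∣ below C x ∣ ℕ.+ ∣ above C x ∣)             ≤⟨ ℕ.+-monoʳ-≤ (g x) (ℕ.+-monoʳ-≤ ∣ below C x ∣ above≤) ⟩
        g x + (∣ below C x ∣ ℕ.+ (k + r ∸ g x))           ≡⟨ ℕ.+-assoc (g x) ∣ below C x ∣ _ ⟨
        g x + ∣ below C x ∣ ℕ.+ (k + r ∸ g x)             ≡⟨ cong (ℕ._+ (k + r ∸ g x)) (ℕ.+-comm (g x) ∣ below C x ∣) ⟩
        ∣ below C x ∣ ℕ.+ g x + (k + r ∸ g x)             ≡⟨ ℕ.+-assoc ∣ below C x ∣ (g x) _ ⟩
        ∣ below C x ∣ ℕ.+ (g x + (k + r ∸ g x))           ≡⟨ cong (∣ below C x ∣ ℕ.+_) (ℕ.m+[n∸m]≡n (ℕ.<⇒≤ (g< x))) ⟩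
        ∣ below C x ∣ ℕ.+ (k + r)                           ≡⟨ ℕ.+-assoc ∣ below C x ∣ k r ⟨
        ∣ below C x ∣ ℕ.+ k + r ∎)
        where
        open ℕ.≤-Reasoning
        -- The very chain that defines `rank x`, so `∣ below C x ∣` is `rank x` by computation.
        C = proj₁ (through x x ⊑-refl)
        max = proj₁ (proj₂ (through x x ⊑-refl))
        x∈C = proj₁ (proj₂ (proj₂ (through x x ⊑-refl)))
        above≤ : ∣ above C x ∣ ≤ k + r ∸ g x
        above≤ = injective⇒∣∣≤ (above C x) g
          (λ y∈ z∈ → g-injective (proj₁ max) (proj₁ (∈-select⁻ (above? C x) y∈)) (proj₁ (∈-select⁻ (above? C x) z∈)))
          (g x) (k + r ∸ g x) (λ {y} y∈ → g-mono (proj₂ (∈-select⁻ (above? C x) y∈)) ,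
            subst (g y <_) (sym (ℕ.m+[n∸m]≡n (ℕ.<⇒≤ (g< x)))) (g< y))

      -- On a maximal chain through both points, the elements from `x` up to but excluding `y`
      -- account for the rank difference and have distinct values in [g x, g y). So `g` minus the
      -- rank is weakly monotone, stated additively to avoid truncated subtraction.
      rank-difference : ∀ {x y} → x ⊑ y → rank y + g x ≤ rank x + g y
      rank-difference {x} {y} x⊑y with C , max , x∈C , y∈C ← through x y x⊑y = begin
        rank y + g x                              ≡⟨ cong (ℕ._+ g x) (∣below∣≡rank max y∈C) ⟨
        ∣ below C y ∣ ℕ.+ g x                       ≤⟨ ℕ.+-monoˡ-≤ (g x) (p⊆q⇒∣p∣≤∣q∣ cover) ⟩
        ∣ below C x ∪ interval ∣ ℕ.+ g x             ≡⟨ cong (ℕ._+ g x) (∣p∪q∣≡∣p∣+∣q∣ (below C x) interval disjoint) ⟩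
        ∣ below C x ∣ ℕ.+ ∣ interval ∣ ℕ.+ g x       ≡⟨ cong (λ n → n + ∣ interval ∣ ℕ.+ g x) (∣below∣≡rank max x∈C) ⟩
        rank x + ∣ interval ∣ ℕ.+ g x              ≤⟨ ℕ.+-monoˡ-≤ (g x) (ℕ.+-monoʳ-≤ (rank x) interval≤) ⟩
        rank x + (g y ∸ g x) + g x              ≡⟨ ℕ.+-assoc (rank x) _ (g x) ⟩
        rank x + (g y ∸ g x + g x)              ≡⟨ cong (rank x ℕ.+_) (ℕ.m∸n+n≡m (g-mono x⊑y)) ⟩
        rank x + g y ∎
        where
        open ℕ.≤-Reasoning
        interval? : Decidable (λ z → z ∈ below C y × x ⊑ z)
        interval? z = (z ∈? below C y) ×-dec (x ⊑? z)
        interval = select interval?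
        cover : below C y ⊆ below C x ∪ interval
        cover {z} z∈ with x ⊑? z | proj₁ max x z x∈C (proj₁ (∈-select⁻ (below? C y) z∈))
        ... | yes x⊑z | _ = x∈p∪q⁺ (inj₂ (∈-select⁺ interval? (z∈ , x⊑z)))
        ... | no x⋢z | inj₁ x⊑z = contradiction x⊑z x⋢z
        ... | no x⋢z | inj₂ z⊑x = x∈p∪q⁺ (inj₁ (∈-select⁺ (below? C x)
                (proj₁ (∈-select⁻ (below? C y) z∈) , z⊑x , λ { refl → x⋢z ⊑-refl })))
        disjoint : ∀ {z} → z ∈ below C x → z ∉ interval
        disjoint z∈b z∈i with _ , z⊑x , z≢x ← ∈-select⁻ (below? C x) z∈b | _ , x⊑z ← ∈-select⁻ interval? z∈i =
          z≢x (antisym z⊑x x⊑z)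
        ∈C : ∀ {z} → z ∈ interval → z ∈ C
        ∈C z∈ = proj₁ (∈-select⁻ (below? C y) (proj₁ (∈-select⁻ interval? z∈)))
        interval≤ : ∣ interval ∣ ≤ g y ∸ g x
        interval≤ = injective⇒∣∣≤ interval g (λ a∈ b∈ → g-injective (proj₁ max) (∈C a∈) (∈C b∈)) (g x) (g y ∸ g x) inWindow
          where
          inWindow : ∀ {z} → z ∈ interval → InWindow (g y ∸ g x) (g x) (g z)
          inWindow {z} z∈ with z∈b , x⊑z ← ∈-select⁻ interval? z∈ with _ , z⊑y , z≢y ← ∈-select⁻ (below? C y) z∈b =
            g-mono x⊑z , subst (g z <_) (sym (ℕ.m+[n∸m]≡n (g-mono x⊑y))) (g-strict z⊑y z≢y)

    -- Adding the ranks to a map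

    private
      ranks : Vec ℕ d
      ranks = Vec.tabulate rank
      lookup-ranks : ∀ i → lookup ranks i ≡ rank i
      lookup-ranks = Vec.lookup∘tabulate rank

      lookup-shifted : ∀ f i → lookup (Vec.zipWith _+_ ranks f) i ≡ rank i + lookup f i
      lookup-shifted f i = trans (Vec.lookup-zipWith _+_ i ranks f) (cong (ℕ._+ lookup f i) (lookup-ranks i))

      strictly : ∀ f → Monotone _≡_ ⊤ f → ∀ {x y} → x ⊑ y → x ≢ y → lookup f x < lookup f y
      strictly f mono {x} {y} x⊑y x≢y with mono x y ∈⊤ ∈⊤ x⊑y
      ... | inj₁ fx<fy = fx<fy
      ... | inj₂ (_ , x≡y) = contradiction x≡y x≢y

      shifted⁻ : ∀ f → Monotone _≡_ ⊤ (Vec.zipWith _+_ ranks f) →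
                 Monotone Always ⊤ f
      shifted⁻ f mono x y _ _ x⊑y = [ inj₁ , (λ eq → inj₂ (eq , _)) ]′ (ℕ.m≤n⇒m<n∨m≡n
        (ℕ.+-cancelˡ-≤ (rank y + rank x) _ _ (begin
          rank y + rank x + lookup f x          ≡⟨ ℕ.+-assoc (rank y) (rank x) _ ⟩
          rank y + (rank x + lookup f x)        ≡⟨ cong (rank y ℕ.+_) (lookup-shifted f x) ⟨
          rank y + g x                            ≤⟨ rank-difference g (strictly (Vec.zipWith _+_ ranks f) mono) x⊑y ⟩
          rank x + g y                            ≡⟨ cong (rank x ℕ.+_) (lookup-shifted f y) ⟩
          rank x + (rank y + lookup f y)        ≡⟨ ℕ.+-assoc (rank x) (rank y) _ ⟨
          rank x + rank y + lookup f y          ≡⟨ cong (ℕ._+ lookup f y) (ℕ.+-comm (rank x) (rank y)) ⟩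
          rank y + rank x + lookup f y ∎)))
        where
        open ℕ.≤-Reasoning
        g = lookup (Vec.zipWith _+_ ranks f)

      shifted⁺ : ∀ f → Monotone Always ⊤ f →
                 Monotone _≡_ ⊤ (Vec.zipWith _+_ ranks f)
      shifted⁺ f mono x y x∈ y∈ x⊑y with x Fin.≟ y
      ... | yes refl = inj₂ (refl , refl)
      ... | no x≢y = inj₁ (subst₂ _<_ (sym (lookup-shifted f x)) (sym (lookup-shifted f y))
              (ℕ.+-mono-<-≤ (rank-strict x⊑y x≢y) ([ ℕ.<⇒≤ , ℕ.≤-reflexive ∘ proj₁ ]′ (mono x y x∈ y∈ x⊑y))))

    -- `rank≤g` and `g<rank+k` confine every strict map into k + r values to the windows [rank x,
    -- rank x + k), so each one arises by adding the ranks to a map into `k` values; `shifted⁻` and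
    -- `shifted⁺` match strict with weak.
    strictCount-shift : ∀ k → strictCount (k + r) ⊤ ≡ weakCount k ⊤
    strictCount-shift k = begin
      strictCount (k + r) ⊤
        ≡⟨ count≡∑monotone Fin._≟_ (k + r) ⊤ ⟩
      ∑ (choices (values (k + r) ⊤)) (λ f → 𝟙 (strict? f))
        ≡⟨ cong (λ xss → ∑ (choices xss) (λ f → 𝟙 (strict? f))) (Vec.map-replicate _ inside d) ⟩
      ∑ (choices (Vec.replicate d (upTo (k + r)))) (λ f → 𝟙 (strict? f))
        ≡⟨ ∑-choices-shift k r ranks (λ i → subst (_≤ r) (sym (lookup-ranks i)) (rank≤r i)) (λ f → 𝟙 (strict? f)) outside≡0 ⟩
      ∑ (choices (Vec.replicate d (upTo k))) (λ f → 𝟙 (strict? (Vec.zipWith _+_ ranks f)))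
        ≡⟨ ∑-cong (choices (Vec.replicate d (upTo k))) (λ f →
             𝟙-cong (strict? (Vec.zipWith _+_ ranks f)) (weak? f) (shifted⁻ f) (shifted⁺ f)) ⟩
      ∑ (choices (Vec.replicate d (upTo k))) (λ f → 𝟙 (weak? f))
        ≡⟨ cong (λ xss → ∑ (choices xss) (λ f → 𝟙 (weak? f))) (Vec.map-replicate _ inside d) ⟨
      ∑ (choices (values k ⊤)) (λ f → 𝟙 (weak? f))
        ≡⟨ count≡∑monotone always? k ⊤ ⟨
      weakCount k ⊤ ∎
      where
      open ≡-Reasoning
      strict? = monotone? Fin._≟_ ⊤
      weak? = monotone? always? ⊤
      outside≡0 : ∀ f → (∀ i → lookup f i < k + r) →
                  ¬ (∀ i → InWindow k (lookup ranks i) (lookup f i)) → 𝟙 (strict? f) ≡ 0ℤ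
      outside≡0 f f< ¬in = 𝟙-no (strict? f) λ mono → ¬in λ i →
        subst (λ c → InWindow k c (lookup f i)) (sym (lookup-ranks i))
          (rank≤g (lookup f) (strictly f mono) i , g<rank+k (lookup f) (strictly f mono) k f< i)

-- Transport from the given poset to its indices

module _ {c ℓ₁ ℓ₂ : Level} (Q : FinitePoset c ℓ₁ ℓ₂) where
  open FinitePoset Q using (size; from; to; enumeration; strictlyInverseˡ; strictlyInverseʳ)
  private module Q = FinitePoset Q

  _⊑_ : Rel (Fin size) ℓ₂
  i ⊑ j = from i Q.≤ from j

  ⊑-isDecPartialOrder : IsDecPartialOrder _≡_ _⊑_
  ⊑-isDecPartialOrder = record
    { isPartialOrder = record
      { isPreorder = record
        { isEquivalence = isEquivalence
        ; reflexive     = λ { refl → Q.refl }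
        ; trans         = Q.trans
        }
      ; antisym = λ {i} {j} i⊑j j⊑i → trans (sym (strictlyInverseˡ i))
          (trans (Inverse.to-cong enumeration (Q.antisym i⊑j j⊑i)) (strictlyInverseˡ j))
      }
    ; _≟_  = Fin._≟_
    ; _≤?_ = λ i j → from i Q.≤? from j
    }

  to-mono : ∀ {x y} → x Q.≤ y → to x ⊑ to y
  to-mono {x} {y} x≤y = Q.trans (Q.reflexive (strictlyInverseʳ x))
    (Q.trans x≤y (Q.reflexive (Q.Eq.sym (strictlyInverseʳ y))))

  to-cancel : ∀ {x y} → to x ⊑ to y → x Q.≤ y
  to-cancel {x} {y} x⊑y = Q.trans (Q.reflexive (Q.Eq.sym (strictlyInverseʳ x)))
    (Q.trans x⊑y (Q.reflexive (strictlyInverseʳ y)))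

  gradedOfRank⇒graded : ∀ {r} → GradedOfRank Q r → Graded ⊑-isDecPartialOrder r
  gradedOfRank⇒graded graded D (chain , max) = graded D
    ( (λ x y x∈C y∈C → Sum.map to-cancel to-cancel (chain (to x) (to y) x∈C y∈C))
    , λ E chainE → max E λ i j i∈E j∈E → chainE (from i) (from j)
        (subst (_∈ E) (sym (strictlyInverseˡ i)) i∈E) (subst (_∈ E) (sym (strictlyInverseˡ j)) j∈E))

  Ω≡weakCount : ∀ k → + Ω Q k ≡ weakCount ⊑-isDecPartialOrder k ⊤
  Ω≡weakCount k = begin
    + Ω Q k
      ≡⟨ length-filter≡∑𝟙 (orderPreserving? Q) (allMaps Q k) ⟩
    ∑ (List.map finToFun (allFin (k ℕ.^ size))) (λ f → 𝟙 (orderPreserving? Q f))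
      ≡⟨ ∑-map (finToFun {k} {size}) (allFin (k ℕ.^ size)) _ ⟩
    ∑ (allFin (k ℕ.^ size)) (λ i → 𝟙 (orderPreserving? Q (finToFun {k} {size} i)))
      ≡⟨ ∑-cong (allFin (k ℕ.^ size)) (λ i → 𝟙-cong (orderPreserving? Q (finToFun {k} {size} i))
           (monotone (Vec.tabulate (toℕ ∘ finToFun {k} {size} i))) (tabulate⁺ (finToFun i)) (tabulate⁻ (finToFun i))) ⟩
    ∑ (allFin (k ℕ.^ size)) (λ i → 𝟙 (monotone (Vec.tabulate (toℕ ∘ finToFun {k} {size} i))))
      ≡⟨ ∑-finToFun size k (λ f → 𝟙 (monotone f)) ⟩
    ∑ (choices (Vec.replicate size (upTo k))) (λ f → 𝟙 (monotone f))
      ≡⟨ cong (λ xss → ∑ (choices xss) (λ f → 𝟙 (monotone f))) (Vec.map-replicate _ inside size) ⟨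
    ∑ (choices (values k ⊤)) (λ f → 𝟙 (monotone f))
      ≡⟨ count≡∑monotone ⊑-isDecPartialOrder (always? ⊑-isDecPartialOrder) k ⊤ ⟨
    weakCount ⊑-isDecPartialOrder k ⊤ ∎
    where
    open ≡-Reasoning
    monotone = monotone? ⊑-isDecPartialOrder (always? ⊑-isDecPartialOrder) ⊤
    Weak = Monotone ⊑-isDecPartialOrder (Always ⊑-isDecPartialOrder) ⊤
    tabulate⁺ : (f : Fin size → Fin k) → OrderPreserving Q f → Weak (Vec.tabulate (toℕ ∘ f))
    tabulate⁺ f mono i j _ _ i⊑j = [ inj₁ , (λ eq → inj₂ (eq , _)) ]′ (ℕ.m≤n⇒m<n∨m≡n
      (subst₂ _≤_ (value i) (value j) (mono i⊑j)))
      where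
      value : ∀ i → toℕ (f (to (from i))) ≡ lookup (Vec.tabulate (toℕ ∘ f)) i
      value i = trans (cong (toℕ ∘ f) (strictlyInverseˡ i)) (sym (Vec.lookup∘tabulate (toℕ ∘ f) i))
    tabulate⁻ : (f : Fin size → Fin k) → Weak (Vec.tabulate (toℕ ∘ f)) → OrderPreserving Q f
    tabulate⁻ f mono {x} {y} x≤y = subst₂ _≤_ (Vec.lookup∘tabulate (toℕ ∘ f) (to x)) (Vec.lookup∘tabulate (toℕ ∘ f) (to y))
      ([ ℕ.<⇒≤ , ℕ.≤-reflexive ∘ proj₁ ]′ (mono (to x) (to y) ∈⊤ ∈⊤ (to-mono x≤y)))

-- Binomial expansion of iterated differences

open import Data.Nat.Combinatorics using (_C_; nCk≡nC[n∸k]; nCk+nC[k+1]≡[n+1]C[k+1]; k>n⇒nCk≡0)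

-- The exponent n + j has the parity of n - j and needs no truncated subtraction.
signedBinomial : ℕ → ℕ → ℤ
signedBinomial n j = -1ℤ ^ (n + j) * + (n C j)

signedBinomial-pascal : ∀ n j → signedBinomial (suc n) (suc j) ≡ signedBinomial n j - signedBinomial n (suc j)
signedBinomial-pascal n j = begin
  -1ℤ * -1ℤ ^ (n + suc j) * + (suc n C suc j)
    ≡⟨ cong₂ (λ e c → -1ℤ * -1ℤ ^ e * c) (ℕ.+-suc n j)
         (trans (cong +_ (sym (nCk+nC[k+1]≡[n+1]C[k+1] n j))) (ℤ.pos-+ (n C j) (n C suc j))) ⟩
  -1ℤ * (-1ℤ * s) * (+ (n C j) ℤ.+ + (n C suc j))
    ≡⟨ expand s _ _ ⟩
  s * + (n C j) - -1ℤ * s * + (n C suc j)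
    ≡⟨ cong (λ e → s * + (n C j) - -1ℤ ^ e * + (n C suc j)) (ℕ.+-suc n j) ⟨
  signedBinomial n j - signedBinomial n (suc j) ∎
  where
  open ≡-Reasoning
  s = -1ℤ ^ (n + j)
  expand : ∀ s x y → -1ℤ * (-1ℤ * s) * (x ℤ.+ y) ≡ s * x - -1ℤ * s * y
  expand = solve-∀

signedBinomial-zero : ∀ n → signedBinomial (suc n) 0 ≡ - signedBinomial n 0
signedBinomial-zero n = trans (cong₂ _*_ (ℤ.-1*i≡-i (-1ℤ ^ (n + 0))) (cong +_ (trans (nC0 (suc n)) (sym (nC0 n)))))
   (sym (ℤ.neg-distribˡ-* (-1ℤ ^ (n + 0)) _))
  where
  nC0 : ∀ n → n C 0 ≡ 1
  nC0 zero    = refl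
  nC0 (suc n) = refl

signedBinomial-> : ∀ n → signedBinomial n (suc n) ≡ 0ℤ
signedBinomial-> n = trans (cong (λ c → -1ℤ ^ (n + suc n) * + c) (k>n⇒nCk≡0 (ℕ.n<1+n n))) (ℤ.*-zeroʳ (-1ℤ ^ (n + suc n)))

Δ^-binomial : ∀ a n (f : ℕ → ℤ) t →
  Δ^ a n f t ≡ ∑< (suc n) (λ j → signedBinomial n j * f (j ℕ.* a + t))
Δ^-binomial a zero    f t = sym (trans (ℤ.+-identityʳ _) (ℤ.*-identityˡ (f t)))
Δ^-binomial a (suc n) f t = begin
  Δ^ a n (λ t → f (a + t) - f t) t
    ≡⟨ Δ^-binomial a n _ t ⟩
  ∑< (suc n) (λ j → c j * (f (a + (j ℕ.* a + t)) - g j))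
    ≡⟨ ∑<-cong (suc n) (λ j _ → trans (cong (λ u → c j * (f u - g j)) (sym (ℕ.+-assoc a (j ℕ.* a) t)))
                                      (distrib (c j) (g (suc j)) (g j))) ⟩
  ∑< (suc n) (λ j → c j * g (suc j) - c j * g j)
    ≡⟨ ∑<-- (suc n) (λ j → c j * g (suc j)) (λ j → c j * g j) ⟩
  upper - ∑< (suc n) (λ j → c j * g j)
    -- Appending the zero term at j = n + 1 and splitting off j = 0 aligns the second sum with the
    -- first, ready for Pascal's rule.
    ≡⟨ cong (λ z → upper - z) padded ⟩
  upper - (c 0 * g 0 ℤ.+ ∑< (suc n) (λ j → c (suc j) * g (suc j)))
    ≡⟨ regroup upper (c 0) (g 0) _ ⟩
  - c 0 * g 0 ℤ.+ (upper - ∑< (suc n) (λ j → c (suc j) * g (suc j)))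
    ≡⟨ cong₂ (λ z w → z * g 0 ℤ.+ w) (sym (signedBinomial-zero n))
         (sym (∑<-- (suc n) (λ j → c j * g (suc j)) (λ j → c (suc j) * g (suc j)))) ⟩
  signedBinomial (suc n) 0 * g 0 ℤ.+ ∑< (suc n) (λ j → c j * g (suc j) - c (suc j) * g (suc j))
    ≡⟨ +-congˡ (signedBinomial (suc n) 0 * g 0) (∑<-cong (suc n) λ j _ →
         trans (factor (c j) (c (suc j)) (g (suc j))) (cong (_* g (suc j)) (sym (signedBinomial-pascal n j)))) ⟩
  ∑< (suc (suc n)) (λ j → signedBinomial (suc n) j * g j) ∎
  where
  open ≡-Reasoning
  c = signedBinomial n
  g : ℕ → ℤ
  g j = f (j ℕ.* a + t)
  upper = ∑< (suc n) (λ j → c j * g (suc j))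
  distrib : ∀ c x y → c * (x - y) ≡ c * x - c * y
  distrib = solve-∀
  factor : ∀ c d x → c * x - d * x ≡ (c - d) * x
  factor = solve-∀
  regroup : ∀ u c x w → u - (c * x ℤ.+ w) ≡ - c * x ℤ.+ (u - w)
  regroup = solve-∀
  padded : ∑< (suc n) (λ j → c j * g j) ≡ ∑< (suc (suc n)) (λ j → c j * g j)
  padded = sym (trans (∑<-last (suc n) (λ j → c j * g j))
    (trans (+-congˡ (∑< (suc n) (λ j → c j * g j)) (cong (_* g (suc n)) (signedBinomial-> n))) (ℤ.+-identityʳ _)))

-- Parity and the folding of the alternating sum

odd⇒1+d≡2⌈d/2⌉ : ∀ d → parity d ≡ 1ℙ → suc d ≡ ⌈ d /2⌉ + ⌈ d /2⌉
odd⇒1+d≡2⌈d/2⌉ (suc zero)    odd = refl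
odd⇒1+d≡2⌈d/2⌉ (suc (suc d)) odd = cong suc (trans (cong suc (odd⇒1+d≡2⌈d/2⌉ d odd)) (sym (ℕ.+-suc ⌈ d /2⌉ ⌈ d /2⌉)))

-1^[2+n] : ∀ n → -1ℤ ^ (2 + n) ≡ -1ℤ ^ n
-1^[2+n] n = cancel (-1ℤ ^ n)
  where
  cancel : ∀ x → -1ℤ * (-1ℤ * x) ≡ x
  cancel = solve-∀

-1^odd : ∀ d → parity d ≡ 1ℙ → -1ℤ ^ d ≡ -1ℤ
-1^odd (suc zero)    odd = refl
-1^odd (suc (suc d)) odd = trans (-1^[2+n] d) (-1^odd d odd)

-1^[2k+n] : ∀ k n → -1ℤ ^ (k + k + n) ≡ -1ℤ ^ n
-1^[2k+n] zero    n = refl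
-1^[2k+n] (suc k) n = trans (cong (λ e → -1ℤ ^ (suc e + n)) (ℕ.+-suc k k))
  (trans (-1^[2+n] (k + k + n)) (-1^[2k+n] k n))

-- The symmetry j ↔ 2N + 1 - j exchanges the two halves of the vanishing difference.
module _ (N a : ℕ) (f g : ℕ → ℤ)
         (upper : ∀ m → f ((suc N + m) ℕ.* a + 0) ≡ g m)
         (lower : ∀ m → m ≤ N → f ((N ∸ m) ℕ.* a + 0) ≡ - g m)
         (vanish : Δ^ a (suc N + N) f 0 ≡ 0ℤ) where

  private
    2N+1 = suc N + N
    term : ℕ → ℤ
    term j = signedBinomial 2N+1 j * f (j ℕ.* a + 0)
    summand : ℕ → ℤ
    summand m = -1ℤ ^ (N + m) * + (2N+1 C (N ∸ m)) * g m

  fold-symmetric : ∑< (suc N) summand ≡ 0ℤ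
  fold-symmetric = x+x≡0⇒x≡0 _ (begin
    ∑< (suc N) summand ℤ.+ ∑< (suc N) summand
      ≡⟨ cong₂ ℤ._+_ (∑<-cong (suc N) λ m m< → lower-term m (ℕ.s≤s⁻¹ m<)) (∑<-cong (suc N) λ m m< → upper-term m (ℕ.s≤s⁻¹ m<)) ⟨
    ∑< (suc N) (λ m → term (N ∸ m)) ℤ.+ ∑< (suc N) (λ m → term (suc N + m))
      ≡⟨ cong (λ z → z ℤ.+ ∑< (suc N) (λ m → term (suc N + m))) (∑<-reverse N term) ⟨
    ∑< (suc N) term ℤ.+ ∑< (suc N) (λ m → term (suc N + m))
      ≡⟨ ∑<-split (suc N) (suc N) term ⟨
    ∑< (suc N + suc N) term
      ≡⟨ cong (λ k → ∑< k term) (ℕ.+-suc (suc N) N) ⟩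
    ∑< (suc 2N+1) term
      ≡⟨ Δ^-binomial a 2N+1 f 0 ⟨
    Δ^ a 2N+1 f 0
      ≡⟨ vanish ⟩
    0ℤ ∎)
    where
    open ≡-Reasoning
    upper-term : ∀ m → m ≤ N → term (suc N + m) ≡ summand m
    upper-term m m≤N = cong₂ _*_ (cong₂ (λ s b → s * + b) sign binomial) (upper m)
      where
      exponent : ∀ N m → (suc N + N) + (suc N + m) ≡ (suc N + suc N) + (N + m)
      exponent = ℕ-Solver.solve-∀
      sign : -1ℤ ^ (2N+1 + (suc N + m)) ≡ -1ℤ ^ (N + m)
      sign = trans (cong (-1ℤ ^_) (exponent N m)) (-1^[2k+n] (suc N) (N + m))
      binomial : 2N+1 C (suc N + m) ≡ 2N+1 C (N ∸ m)
      binomial = trans (nCk≡nC[n∸k] (ℕ.+-monoʳ-≤ (suc N) m≤N)) (cong (2N+1 C_) (ℕ.[m+n]∸[m+o]≡n∸o (suc N) N m))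
    lower-term : ∀ m → m ≤ N → term (N ∸ m) ≡ summand m
    lower-term m m≤N = begin
      -1ℤ ^ (2N+1 + (N ∸ m)) * b * f ((N ∸ m) ℕ.* a + 0)
        ≡⟨ cong₂ (λ s x → s * b * x) sign (lower m m≤N) ⟩
      -1ℤ * -1ℤ ^ (N + m) * b * - g m
        ≡⟨ cancel (-1ℤ ^ (N + m)) b (g m) ⟩
      -1ℤ ^ (N + m) * b * g m ∎
      where
      b = + (2N+1 C (N ∸ m))
      cancel : ∀ s b x → -1ℤ * s * b * - x ≡ s * b * x
      cancel = solve-∀
      -- Here e stands for N - m. The exponent differs from N + m by the odd number 2e + 1, and the
      -- resulting sign absorbs the minus from `lower`.
      exponent : ∀ e m → (suc (e + m) + (e + m)) + e ≡ suc ((e + e) + ((e + m) + m))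
      exponent = ℕ-Solver.solve-∀
      exponent′ : 2N+1 + (N ∸ m) ≡ suc (((N ∸ m) + (N ∸ m)) + (N + m))
      exponent′ = subst (λ M → (suc M + M) + (N ∸ m) ≡ suc (((N ∸ m) + (N ∸ m)) + (M + m)))
        (ℕ.m∸n+n≡m m≤N) (exponent (N ∸ m) m)
      sign : -1ℤ ^ (2N+1 + (N ∸ m)) ≡ -1ℤ * -1ℤ ^ (N + m)
      sign = trans (cong (-1ℤ ^_) exponent′) (cong (-1ℤ *_) (-1^[2k+n] (N ∸ m) (N + m)))

-- The sequence at the points m = -N - 1, ..., N

theorem5p12 : ∀ {c ℓ₁ ℓ₂} (Q : FinitePoset c ℓ₁ ℓ₂) (d r : ℕ) →
    FinitePoset.size Q ≡ d →
    GradedOfRank Q r →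
    parity d ≡ 1ℙ →
    let N = ⌈ d /2⌉ in
    ∑[ m ≤ N ] (-1ℤ ^ (N + toℕ m) * + ((d + 2) C (N ∸ toℕ m)) * + Ω Q (toℕ m ℕ.* (r + 2) + 1)) ≡ 0ℤ
theorem5p12 Q d r refl graded odd = trans
  (∑<-cong (suc N) {g = λ m → -1ℤ ^ (N + m) * + ((d + 2) C (N ∸ m)) * + Ω Q (m ℕ.* (r + 2) + 1)} λ m _ →
     cong₂ (λ n w → -1ℤ ^ (N + m) * + (n C (N ∸ m)) * w) d+2≡ (Ω≡weakCount Q (m ℕ.* (r + 2) + 1)))
  (fold-symmetric N (r + 2) (window order M ⊤) (λ m → weakCount order (m ℕ.* (r + 2) + 1) ⊤) upper lower
    (Δ^-window order (r + 2) M (suc N + N) ⊤ (subst₂ _<_ (sym (∣⊤∣≡n d)) d+2≡ (ℕ.m<m+n d ℕ.z<s)) 0))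
  where
  open ≡-Reasoning
  order = ⊑-isDecPartialOrder Q
  N = ⌈ d /2⌉
  -- M = (N + 1)(r + 2) - 1, so position j(r + 2) of the window is the integer (j - N - 1)(r + 2) +
  -- 1 and j = 0 corresponds to m = -N - 1.
  M = N ℕ.* (r + 2) + (r + 1)
  d+2≡ : d + 2 ≡ suc N + N
  d+2≡ = trans (ℕ.+-comm d 2) (cong suc (odd⇒1+d≡2⌈d/2⌉ d odd))
  upper : ∀ m → window order M ⊤ ((suc N + m) ℕ.* (r + 2) + 0) ≡ weakCount order (m ℕ.* (r + 2) + 1) ⊤
  upper m = cong (orderFunction order ⊤) (trans
    (cong₂ _⊖_ (position N m r) (sym (ℕ.+-identityʳ M))) (ℤ.+-cancelˡ-⊖ M (m ℕ.* (r + 2) + 1) 0))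
    where
    position : ∀ N m r → (suc N + m) ℕ.* (r + 2) + 0 ≡ (N ℕ.* (r + 2) + (r + 1)) + (m ℕ.* (r + 2) + 1)
    position = ℕ-Solver.solve-∀
  lower : ∀ m → m ≤ N → window order M ⊤ ((N ∸ m) ℕ.* (r + 2) + 0) ≡ - weakCount order (m ℕ.* (r + 2) + 1) ⊤
  lower m m≤N = begin
    orderFunction order ⊤ ((N ∸ m) ℕ.* (r + 2) + 0 ⊖ M)
      ≡⟨ cong (λ M → orderFunction order ⊤ ((N ∸ m) ℕ.* (r + 2) + 0 ⊖ M)) M≡ ⟩
    -- The common multiple of r + 2 cancels and leaves -(k + r), the mirror image of `k`, where the
    -- strict maps take over.
    orderFunction order ⊤ ((N ∸ m) ℕ.* (r + 2) + 0 ⊖ ((N ∸ m) ℕ.* (r + 2) + (k + r)))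
      ≡⟨ cong (orderFunction order ⊤) (trans (ℤ.+-cancelˡ-⊖ ((N ∸ m) ℕ.* (r + 2)) 0 (k + r)) (ℤ.⊖-≤ {n = k + r} ℕ.z≤n)) ⟩
    orderFunction order ⊤ (- + (k + r))
      ≡⟨ orderFunction-neg order ⊤ (k + r) ⟩
    sgn (⊤ {d}) * strictCount order (k + r) ⊤
      ≡⟨ cong₂ _*_ (trans (cong (-1ℤ ^_) (∣⊤∣≡n d)) (-1^odd d odd))
                   (strictCount-shift order (gradedOfRank⇒graded Q graded) k) ⟩
    -1ℤ * weakCount order k ⊤
      ≡⟨ ℤ.-1*i≡-i _ ⟩
    - weakCount order k ⊤ ∎
    where
    k = m ℕ.* (r + 2) + 1
    position : ∀ e m r → (e + m) ℕ.* (r + 2) + (r + 1) ≡ e ℕ.* (r + 2) + (m ℕ.* (r + 2) + 1 + r)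
    position = ℕ-Solver.solve-∀
    M≡ : M ≡ (N ∸ m) ℕ.* (r + 2) + (k + r)
    M≡ = trans (cong (λ N → N ℕ.* (r + 2) + (r + 1)) (sym (ℕ.m∸n+n≡m m≤N))) (position (N ∸ m) m r)
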